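{- Let $k\ge 2$ and let $\mathcal{P}$ be a chiral $(2k+1)$-polytope with simple Petrie polygons. Fix a base flag $\Phi$ of $\mathcal{P}$ and for $1\le i\le 2k$ let $\tau_i$ be the automorphism with $\Phi\tau_i=r_ir_0\Phi$, so that $\Gamma(\mathcal{P})=\langle\tau_1,\dots,\tau_{2k}\rangle$. Let $\mathcal{X}$ be the family-2 premaniplex with $4k$ sides, with 1-faces $e_0,\dots,e_{4k-1}$, and let $\xi$ be the voltage assignment on $\mathcal{X}$ giving trivial voltage to all darts of colors 0 and 1, and, for $0\le i<2k$, voltage $\tau_{i+1}$ to each dart of color 2 starting at a flag of $e_i$ (hence voltage $\tau_{i+1}^{ -1}$ to the darts of color 2 starting at a flag of $e_{2k+i}$). Then $\mathcal{X}^\xi$ is a polyhedron (abstract 3-polytope) whose symmetry type graph is isomorphic to $\mathcal{X}$. In particular $\mathcal{X}^\xi$ is vertex-transitive, facet-transitive and has trivial facet stabilizer.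
   Context: Graphs may have semi-edges and parallel edges: a graph has vertices, darts, an initial-vertex map $I$ and an involution $d\mapsto d^{ -1}$ on darts; $T(d)=I(d^{ -1})$. An $n$-premaniplex is a connected graph with edges colored by $\{0,\dots,n-1\}$ such that every vertex (flag) is incident to exactly one edge of each color and for $|i-j|>1$ alternating paths of length 4 in colors $i,j$ are closed; an $n$-maniplex is a simple $n$-premaniplex. $r_i\Phi$ is the flag joined to $\Phi$ by its edge of color $i$. The $i$-faces are the connected components after deleting the color-$i$ edges ($0$-faces: vertices; $(n-1)$-faces: facets). Automorphisms are color-preserving graph automorphisms, acting on the right. An abstract $n$-polytope is an $n$-maniplex such that whenever two flags are joined by a path with colors in $[0,m]$ and by one with colors in $[k',n-1]$, they are joined by a path with colors in $[k',m]$; a polyhedron is a 3-polytope. A maniplex is chiral if its automorphism group has exactly two flag orbits and adjacent flags lie in different orbits. A Petrie polygon is an orbit of flags under $r_{n-1}\cdots r_1r_0$; it is simple if distinct flags in it lie in distinct vertices. Family-2 premaniplex with $4k$ sides: start from a $4k$-gon (a 2-premaniplex whose $8k$ flags form a cycle alternating colors 0,1), fix a flag $y_0$, let $e_i$ ($0\le i\le 4k-1$) be the 1-face $\{(r_1r_0)^iy_0,\ r_0(r_1r_0)^iy_0\}$, and add an edge of color 2 joining each flag $y$ to $r_0(r_1r_0)^{2k}y$ (so flags of $e_i$ are joined to flags of $e_{i+2k}$, indices mod $4k$). A voltage assignment with group $\Gamma$ is a map $\xi$ from darts to $\Gamma$ with $\xi(d^{ -1})=\xi(d)^{ -1}$.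 The derived graph $\mathcal{X}^\xi$ has vertex set $V(\mathcal{X})\times\Gamma$ and dart set $D(\mathcal{X})\times\Gamma$, the dart $(d,\gamma)$ going from $(I(d),\gamma)$ to $(T(d),\xi(d)\gamma)$, with $(d,\gamma)^{ -1}=(d^{ -1},\xi(d)\gamma)$ and colors inherited. The symmetry type graph of a maniplex has the flag orbits of its automorphism group as vertices, with an edge of color $i$ between the orbits of $\Phi$ and $r_i\Phi$ (a semi-edge if equal). Vertex-/facet-transitive means the automorphism group is transitive on vertices/facets; trivial facet stabilizer means only the identity maps a facet to itself. -}

module Defs where

open import Data.Nat as ℕ using (ℕ; zero; suc; _∸_; _≤_; _<_)
open import Data.Nat.DivMod using (_mod_)
open import Data.Fin as Fin using (Fin; toℕ; splitAt)
open import Data.Fin.Properties using (nonZeroIndex)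
open import Data.Bool using (Bool; true; false; not)
open import Data.List using (List; []; _∷_; allFin)
open import Data.List.Relation.Unary.All using (All)
open import Data.Product using (Σ; ∃; _×_; _,_; proj₁; proj₂)
open import Data.Sum using (_⊎_; inj₁; inj₂)
open import Data.Unit using (⊤)
open import Relation.Binary.Structures using (IsEquivalence)
open import Relation.Binary.PropositionalEquality
  using (_≡_; _≢_; refl; sym; trans; cong; isEquivalence)
open import Relation.Nullary using (¬_)

-- Raw edge-coloured flag graphs of rank n.
-- Flags form a setoid (needed because the voltage group below is a group
-- of automorphisms, whose equality is pointwise).  r i x is the flag
-- joined to x by its (unique) edge of colour i; a semi-edge of colour i
-- at x is the case  r i x ≈ x.  The dart of colour i starting at x goes
-- to r i x; its inverse is the dart of colour i starting at r i x.

record Raw (n : ℕ) : Set₁ where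
  field
    Flag  : Set
    _≈_   : Flag → Flag → Set
    isEq  : IsEquivalence _≈_
    r     : Fin n → Flag → Flag
    r-cong : ∀ i {x y} → x ≈ y → r i x ≈ r i y

open Raw public

module _ {n : ℕ} (G : Raw n) where

  private
    _≈G_ = _≈_ G

  act : List (Fin n) → Flag G → Flag G
  act []      x = x
  act (i ∷ w) x = act w (r G i x)

  PathIn : (Fin n → Set) → Flag G → Flag G → Set
  PathIn P x y = Σ (List (Fin n)) λ w → All P w × (act w x ≈G y)

  SameFace : Fin n → Flag G → Flag G → Set
  SameFace i = PathIn (λ j → j ≢ i)

  record IsPremaniplex : Set where
    field
      r-invol : ∀ i x → r G i (r G i x) ≈G x
      -- |i - j| > 1  (written with truncated subtraction)
      r-comm  : ∀ i j → 1 < ((toℕ i ∸ toℕ j) ℕ.+ (toℕ j ∸ toℕ i)) →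
                ∀ x → r G i (r G j (r G i (r G j x))) ≈G x
      connected : ∀ x y → PathIn (λ _ → ⊤) x y

  record IsManiplex : Set where
    field
      premaniplex : IsPremaniplex
      noSemiEdge  : ∀ i x → ¬ (r G i x ≈G x)
      noParallel  : ∀ i j x → i ≢ j → ¬ (r G i x ≈G r G j x)

  record IsPolytope : Set where
    field
      maniplex : IsManiplex
      diamond  : ∀ (m k′ : Fin n) x y →
                 PathIn (λ j → toℕ j ≤ toℕ m) x y →
                 PathIn (λ j → toℕ k′ ≤ toℕ j) x y →
                 PathIn (λ j → toℕ k′ ≤ toℕ j × toℕ j ≤ toℕ m) x y

record Iso {n : ℕ} (G H : Raw n) : Set where
  field
    to        : Flag G → Flag H
    from      : Flag H → Flag G
    to-cong   : ∀ {x y} → _≈_ G x y → _≈_ H (to x) (to y)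
    from-cong : ∀ {x y} → _≈_ H x y → _≈_ G (from x) (from y)
    to-r      : ∀ i x → _≈_ H (to (r G i x)) (r H i (to x))
    to-from   : ∀ x → _≈_ H (to (from x)) x
    from-to   : ∀ x → _≈_ G (from (to x)) x

open Iso public

Aut : {n : ℕ} → Raw n → Set
Aut G = Iso G G

module _ {n : ℕ} {G : Raw n} where

  private
    module E = IsEquivalence (isEq G)
    _≈G_ = _≈_ G

  _·_ : Flag G → Aut G → Flag G
  x · γ = to γ x

  _≈A_ : Aut G → Aut G → Set
  γ ≈A δ = ∀ x → (x · γ) ≈G (x · δ)

  idAut : Aut G
  idAut = record { to = λ x → x ; from = λ x → x
                 ; to-cong = λ p → p ; from-cong = λ p → p
                 ; to-r = λ i x → E.refl ; to-from = λ x → E.refl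
                 ; from-to = λ x → E.refl }

  -- product for a right action:  x · (α ∘A β) = (x · α) · β
  _∘A_ : Aut G → Aut G → Aut G
  α ∘A β = record
    { to = λ x → to β (to α x)
    ; from = λ x → from α (from β x)
    ; to-cong = λ p → to-cong β (to-cong α p)
    ; from-cong = λ p → from-cong α (from-cong β p)
    ; to-r = λ i x → E.trans (to-cong β (to-r α i x)) (to-r β i (to α x))
    ; to-from = λ x → E.trans (to-cong β (to-from α (from β x))) (to-from β x)
    ; from-to = λ x → E.trans (from-cong α (from-to β (to α x))) (from-to α x) }

  invAut : Aut G → Aut G
  invAut α = record
    { to = from α ; from = to α
    ; to-cong = from-cong α ; from-cong = to-cong α
    ; to-r = λ i x → E.trans (from-cong α (r-cong G i (E.sym (to-from α x))))
                     (E.trans (from-cong α (E.sym (to-r α i (from α x))))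
                              (from-to α (r G i (from α x))))
    ; to-from = from-to α ; from-to = to-from α }

  SameOrbit : Flag G → Flag G → Set
  SameOrbit x y = Σ (Aut G) λ γ → (x · γ) ≈G y

  IsChiral : Set
  IsChiral = (Σ (Flag G) λ a → Σ (Flag G) λ b →
                 ¬ SameOrbit a b × (∀ z → SameOrbit z a ⊎ SameOrbit z b))
             × (∀ i x → ¬ SameOrbit x (r G i x))

  FaceTransitive : Fin n → Set
  FaceTransitive i = ∀ x y → Σ (Aut G) λ γ → SameFace G i (x · γ) y

  TrivialFaceStabilizer : Fin n → Set
  TrivialFaceStabilizer i =
    ∀ (γ : Aut G) x → SameFace G i (x · γ) x → γ ≈A idAut

module _ {m : ℕ} (G : Raw (suc m)) where

  VertexTransitive : Set
  VertexTransitive = FaceTransitive {G = G} Fin.zero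

  FacetTransitive : Set
  FacetTransitive = FaceTransitive {G = G} (Fin.fromℕ m)

  TrivialFacetStabilizer : Set
  TrivialFacetStabilizer = TrivialFaceStabilizer {G = G} (Fin.fromℕ m)

  petrie : Flag G → Flag G
  petrie = act G (allFin (suc m))

  iter : ℕ → Flag G → Flag G
  iter zero    x = x
  iter (suc j) x = petrie (iter j x)

  SamePetrie : Flag G → Flag G → Set
  SamePetrie x y = Σ ℕ λ j → _≈_ G (iter j x) y ⊎ _≈_ G (iter j y) x

  SimplePetriePolygons : Set
  SimplePetriePolygons =
    ∀ x y → SamePetrie x y → ¬ _≈_ G x y → ¬ SameFace G Fin.zero x y

SymmetryTypeGraph : {n : ℕ} → Raw n → Raw n
SymmetryTypeGraph {n} G = record
  { Flag = Flag G
  ; _≈_ = SameOrbit {G = G}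
  ; isEq = record
      { refl = λ {x} → idAut , E.refl
      ; sym = λ { {x} {y} (γ , p) →
          invAut γ , E.trans (from-cong γ (E.sym p)) (from-to γ x) }
      ; trans = λ { (γ , p) (δ , q) → (γ ∘A δ) , E.trans (to-cong δ p) q } }
  ; r = r G
  ; r-cong = λ { i (γ , p) → γ , E.trans (to-r γ i _) (r-cong G i p) } }
  where module E = IsEquivalence (isEq G)

≡Raw : {n : ℕ} (F : Set) → (Fin n → F → F) → Raw n
≡Raw F ρ = record { Flag = F ; _≈_ = _≡_ ; isEq = isEquivalence
                  ; r = ρ ; r-cong = λ i p → cong (ρ i) p }

-- Derived graph of a base graph (with ≡ on flags) under a voltage
-- assignment ξ with values in Aut P.  The dart of colour i at x carries
-- voltage ξ i x; the dart (d , γ) goes from (x , γ) to (r i x , ξ i x γ).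

Derived : {n m : ℕ} (F : Set) (ρ : Fin n → F → F) (P : Raw m)
          (ξ : Fin n → F → Aut P) → Raw n
Derived F ρ P ξ = record
  { Flag = F × Aut P
  ; _≈_ = λ { (x , γ) (y , δ) → x ≡ y × γ ≈A δ }
  ; isEq = record
      { refl = refl , λ _ → E.refl
      ; sym = λ { (p , q) → sym p , λ z → E.sym (q z) }
      ; trans = λ { (p , q) (p′ , q′) → trans p p′ , λ z → E.trans (q z) (q′ z) } }
  ; r = λ i → λ { (x , γ) → ρ i x , (ξ i x ∘A γ) }
  ; r-cong = λ { i {x , γ} {.x , δ} (refl , q) → refl , λ z → q (to (ξ i x) z) } }
  where module E = IsEquivalence (isEq P)

-- The family-2 premaniplex with 4k sides.
-- The 4k-gon: sides indexed by Fin (2k + 2k) (i.e. ℤ/4k); the flag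
-- (i , false) is (r1 r0)^i y0 and (i , true) is r0 (r1 r0)^i y0, so the
-- 1-face e_i is {(i , false) , (i , true)} and y0 = (0 , false).

cycSuc : {n : ℕ} → Fin n → Fin n
cycSuc {n} i = (suc (toℕ i) mod n) {{nonZeroIndex i}}

cycPred : {n : ℕ} → Fin n → Fin n
cycPred {n} i = ((toℕ i ℕ.+ (n ∸ 1)) mod n) {{nonZeroIndex i}}

module Family2 (k : ℕ) where

  Side : Set
  Side = Fin (2 ℕ.* k ℕ.+ 2 ℕ.* k)

  XFlag : Set
  XFlag = Side × Bool

  r0 : XFlag → XFlag
  r0 (i , b) = i , not b

  r1 : XFlag → XFlag
  r1 (i , false) = cycPred i , true
  r1 (i , true)  = cycSuc i , false

  r10^ : ℕ → XFlag → XFlag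
  r10^ zero    y = y
  r10^ (suc j) y = r1 (r0 (r10^ j y))

  r2 : XFlag → XFlag
  r2 y = r0 (r10^ (2 ℕ.* k) y)

  ρX : Fin 3 → XFlag → XFlag
  ρX Fin.zero                       = r0
  ρX (Fin.suc Fin.zero)             = r1
  ρX (Fin.suc (Fin.suc Fin.zero))   = r2

  X : Raw 3
  X = ≡Raw XFlag ρX

  -- the voltage assignment of the theorem, for given τ_1 … τ_{2k}
  -- (τ j  stands for τ_{j+1}):  colours 0, 1 trivial; the colour-2 dart
  -- at a flag of e_i gets τ_{i+1} for i < 2k and τ_{i-2k+1}⁻¹ otherwise.
  ξ : {P : Raw (suc (2 ℕ.* k))} → (Fin (2 ℕ.* k) → Aut P) →
      Fin 3 → XFlag → Aut P
  ξ τ Fin.zero                 _       = idAut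
  ξ τ (Fin.suc Fin.zero)       _       = idAut
  ξ τ (Fin.suc (Fin.suc Fin.zero)) (i , _) with splitAt (2 ℕ.* k) i
  ... | inj₁ j = τ j
  ... | inj₂ j = invAut (τ j)

  Xξ : {P : Raw (suc (2 ℕ.* k))} → (Fin (2 ℕ.* k) → Aut P) → Raw 3
  Xξ {P} τ = Derived XFlag ρX P (ξ τ)

{-# OPTIONS --safe #-}
module Submission where

open import Defs
open import Data.Nat using (ℕ; suc; _≤_; _*_)
open import Data.Fin using (Fin; zero)
open import Data.Product using (_×_)
open import Data.Nat as ℕ using (zero; _+_; _∸_; _<_; z≤n; s≤s)
import Data.Nat.Properties as ℕₚ
open import Data.Nat.DivMod using (_mod_; _%_; m<n⇒m%n≡m; %-distribˡ-+; m%n%n≡m%n; [m+n]%n≡m%n)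
open import Data.Fin as Fin using (toℕ; fromℕ<; _↑ˡ_; _↑ʳ_; splitAt)
open import Data.Fin.Patterns using (0F; 1F; 2F)
import Data.Fin.Properties as Finₚ
open import Data.Bool as Bool using (Bool; true; false; not; _xor_)
open import Data.Bool.Properties using (not-involutive; not-¬; ¬-not)
open import Data.List using (List; []; _∷_; _++_; reverse; tabulate; allFin; concatMap)
import Data.List.Properties as Listₚ
open import Data.List.Relation.Unary.All as All using (All; []; _∷_)
import Data.List.Relation.Unary.All.Properties as Allₚ
open import Data.Product using (Σ; _,_; proj₁; proj₂)
open import Data.Sum using (_⊎_; inj₁; inj₂)
open import Data.Unit using (⊤; tt)
open import Data.Empty using (⊥; ⊥-elim)
open import Relation.Binary.Bundles using (Setoid)
open import Relation.Binary.Structures using (IsEquivalence)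
open import Relation.Binary.Definitions using (tri<; tri≈; tri>)
open import Relation.Binary.PropositionalEquality as ≡
  using (_≡_; _≢_; refl; cong; cong₂; subst)
open import Relation.Nullary using (¬_; yes; no)
import Relation.Binary.Reasoning.Setoid as SetoidReasoning

-- Polytopality.  Follow a path around a vertex of the derived graph from (x , γ):
-- the flags Φγ it meets, with r₀ applied at every other corner, run through a walk of P
-- that applies r₀ , r₁ , … , r₂ₖ cyclically, that is, along a Petrie polygon.  If the path
-- returns to the same γ, two stages of this walk agree or differ by r₀; simplicity
-- of the Petrie polygon puts them in the same round, and the diamond condition of P
-- then forces the two corners to be equal.  So a facet meets a vertex
-- in at most one corner.
--
-- Symmetry type.  Γ acts by right translation, so it suffices that an automorphism
-- cannot send (y₀ , γ) over another flag y of X.  Closed words give relations between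
-- the voltages, read from y₀ and from y.  They would force τ₁² = 1 (r₀ and r₁ commute),
-- or (τ₁τ₂)² = 1 (r₁ and r₂ commute), or an automorphism inverting every τᵢ; each
-- yields an automorphism of P taking Φ to r₀Φ, against chirality.

-- Colours 0 and 1 carry trivial voltage, so each facet of the derived graph is a copy of the 4k-gon
-- labelled by one group element γ. Around a vertex the sides crossed alternate between the two
-- halves of the polygon, so τ's and inverse τ's alternate. This is why r₀ enters at every other
-- corner: from Φτⱼ⁻¹ = r₀rⱼΦ follows (r₀Φ)τⱼ⁻¹ = rⱼr₀(r₀Φ), so τⱼ⁻¹ moves r₀Φ by the same word by
-- which τⱼ moves Φ. The half of a side and the choice between Φ and r₀Φ are therefore carried by
-- one boolean. Since P is connected, an automorphism is determined by the image of one flag, and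
-- relations between voltages are tested at a single flag. A word of P can be rewritten as a product
-- of τ's only if its length is even. Chirality supplies this: adjacent flags lie in different
-- orbits and there are only two orbits, so a word joining flags of one orbit is even.

pattern 2+ i = Fin.suc (Fin.suc i)

-- Words, paths and orbits in a coloured flag graph.

module Graph {n : ℕ} (G : Raw n) where

  infix 4 _≋_
  _≋_ : Flag G → Flag G → Set
  _≋_ = _≈_ G

  open IsEquivalence (isEq G) public
    renaming (refl to ≋-refl; sym to ≋-sym; trans to ≋-trans; reflexive to ≋-reflexive)

  setoid : Setoid _ _
  setoid = record { isEquivalence = isEq G }

  module ≋-Reasoning = SetoidReasoning setoid

  act-cong : ∀ w {x y} → x ≋ y → act G w x ≋ act G w y
  act-cong []      p = p
  act-cong (i ∷ w) p = act-cong w (r-cong G i p)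

  act-++ : ∀ u v x → act G (u ++ v) x ≡ act G v (act G u x)
  act-++ []      v x = refl
  act-++ (i ∷ u) v x = act-++ u v (r G i x)

  act-aut : (α : Aut G) → ∀ w x → (act G w x · α) ≋ act G w (x · α)
  act-aut α []      x = ≋-refl
  act-aut α (i ∷ w) x = ≋-trans (act-aut α w (r G i x)) (act-cong w (to-r α i x))

  act-comm : ∀ {Q : Fin n → Set} i → (∀ j → Q j → ∀ x → r G i (r G j x) ≋ r G j (r G i x)) →
             ∀ {w} → All Q w → ∀ x → r G i (act G w x) ≋ act G w (r G i x)
  act-comm i c []       x = ≋-refl
  act-comm i c {j ∷ w} (q ∷ qs) x =
    ≋-trans (act-comm i c qs (r G j x)) (act-cong w (c j q x))

  path-refl : ∀ {Q x y} → x ≋ y → PathIn G Q x y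
  path-refl p = [] , [] , p

  path-trans : ∀ {Q x y z} → PathIn G Q x y → PathIn G Q y z → PathIn G Q x z
  path-trans {x = x} (u , qu , p) (v , qv , q) = u ++ v , Allₚ.++⁺ qu qv ,
    ≋-trans (≋-reflexive (act-++ u v x)) (≋-trans (act-cong v p) q)

  path-step : ∀ {Q} i x → Q i → PathIn G Q x (r G i x)
  path-step i x q = i ∷ [] , q ∷ [] , ≋-refl

  path-weaken : ∀ {Q S x y} → (∀ {j} → Q j → S j) → PathIn G Q x y → PathIn G S x y
  path-weaken f (w , q , p) = w , All.map f q , p

  path-empty : ∀ {Q x y} → (∀ j → ¬ Q j) → PathIn G Q x y → x ≋ y
  path-empty ¬q ([] , _ , p)        = p
  path-empty ¬q (j ∷ _ , q ∷ _ , _) = ⊥-elim (¬q j q)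

  orbit-refl : ∀ {x y} → x ≋ y → SameOrbit {G = G} x y
  orbit-refl p = idAut , p

  orbit-sym : ∀ {x y} → SameOrbit {G = G} x y → SameOrbit {G = G} y x
  orbit-sym = IsEquivalence.sym (isEq (SymmetryTypeGraph G))

  orbit-trans : ∀ {x y z} → SameOrbit {G = G} x y → SameOrbit {G = G} y z → SameOrbit {G = G} x z
  orbit-trans = IsEquivalence.trans (isEq (SymmetryTypeGraph G))

  orbit-act : ∀ w {x y} → SameOrbit {G = G} x y → SameOrbit {G = G} (act G w x) (act G w y)
  orbit-act w (α , p) = α , ≋-trans (act-aut α w _) (act-cong w p)

  aut-injective : (α : Aut G) → ∀ {x y} → (x · α) ≋ (y · α) → x ≋ y
  aut-injective α p = ≋-trans (≋-sym (from-to α _)) (≋-trans (from-cong α p) (from-to α _))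

all-reverse : ∀ {A : Set} {Q : A → Set} {w} → All Q w → All Q (reverse w)
all-reverse []                    = []
all-reverse {Q = Q} {i ∷ w} (q ∷ qs) =
  subst (All Q) (≡.sym (Listₚ.unfold-reverse i w)) (Allₚ.++⁺ (all-reverse qs) (q ∷ []))

module Involutive {n : ℕ} (G : Raw n) (r-invol : ∀ i x → _≈_ G (r G i (r G i x)) x) where

  open Graph G

  r-move : ∀ i {x y} → r G i x ≋ y → x ≋ r G i y
  r-move i p = ≋-trans (≋-sym (r-invol i _)) (r-cong G i p)

  act-reverse : ∀ w x → act G (reverse w) (act G w x) ≋ x
  act-reverse []      x = ≋-refl
  act-reverse (i ∷ w) x = begin
    act G (reverse (i ∷ w)) y         ≡⟨ cong (λ v → act G v y) (Listₚ.unfold-reverse i w) ⟩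
    act G (reverse w ++ i ∷ []) y     ≡⟨ act-++ (reverse w) (i ∷ []) y ⟩
    r G i (act G (reverse w) y)       ≈⟨ r-cong G i (act-reverse w (r G i x)) ⟩
    r G i (r G i x)                   ≈⟨ r-invol i x ⟩
    x                                 ∎
    where
      open ≋-Reasoning
      y = act G w (r G i x)

  act-injective : ∀ w {x y} → act G w x ≋ act G w y → x ≋ y
  act-injective w p =
    ≋-trans (≋-sym (act-reverse w _)) (≋-trans (act-cong (reverse w) p) (act-reverse w _))

  path-sym : ∀ {Q x y} → PathIn G Q x y → PathIn G Q y x
  path-sym {x = x} (w , q , p) = reverse w , all-reverse q ,
    ≋-trans (act-cong (reverse w) (≋-sym p)) (act-reverse w x)

  comm-of-closed : ∀ i j x → r G i (r G j (r G i (r G j x))) ≋ x →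
                   r G i (r G j x) ≋ r G j (r G i x)
  comm-of-closed i j x p = r-move j (r-move i p)

-- Automorphisms of connected flag graphs.

module Connected {n : ℕ} (G : Raw n) (pm : IsPremaniplex G) where

  open Graph G
  open IsPremaniplex pm
  open Involutive G r-invol

  aut-determined : (α β : Aut G) → ∀ x → (x · α) ≋ (x · β) → α ≈A β
  aut-determined α β x p y with connected x y
  ... | w , _ , q = begin
    y · α            ≈⟨ to-cong α q ⟨
    act G w x · α    ≈⟨ act-aut α w x ⟩
    act G w (x · α)  ≈⟨ act-cong w p ⟩
    act G w (x · β)  ≈⟨ act-aut β w x ⟨
    act G w x · β    ≈⟨ to-cong β q ⟩
    y · β            ∎
    where open ≋-Reasoning

  -- The automorphism sends `act G w x` to `act G w y`. The two hypotheses say that this, and its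
  -- inverse, do not depend on the word chosen to reach a flag.
  orbit-of-stabilisers : ∀ {x y} →
    (∀ w → act G w x ≋ x → act G w y ≋ y) →
    (∀ w → act G w y ≋ y → act G w x ≋ x) → SameOrbit {G = G} x y
  orbit-of-stabilisers {x} {y} xy yx = α , xy (word x x) (reach x x)
    where
      word : Flag G → Flag G → List (Fin n)
      word a z = proj₁ (connected a z)

      reach : ∀ a z → act G (word a z) a ≋ z
      reach a z = proj₂ (proj₂ (connected a z))

      Transfers : Flag G → Flag G → Set
      Transfers a b = ∀ w → act G w a ≋ a → act G w b ≋ b

      transfer : ∀ {a b} → Transfers a b → ∀ u v → act G u a ≋ act G v a → act G u b ≋ act G v b
      transfer {a} {b} t u v p = act-injective (reverse v) (begin
        act G (reverse v) (act G u b)  ≡⟨ act-++ u (reverse v) b ⟨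
        act G (u ++ reverse v) b       ≈⟨ t (u ++ reverse v) closed ⟩
        b                              ≈⟨ act-reverse v b ⟨
        act G (reverse v) (act G v b)  ∎)
        where
          open ≋-Reasoning
          closed = ≋-trans (≋-reflexive (act-++ u (reverse v) a))
                     (≋-trans (act-cong (reverse v) p) (act-reverse v a))

      swap : Flag G → Flag G → Flag G → Flag G
      swap a b z = act G (word a z) b

      swap-word : ∀ {a b} → Transfers a b → ∀ w {z} → act G w a ≋ z → swap a b z ≋ act G w b
      swap-word {a} t w {z} p = transfer t (word a z) w (≋-trans (reach a z) (≋-sym p))

      swap-cong : ∀ {a b} → Transfers a b → ∀ {z z′} → z ≋ z′ → swap a b z ≋ swap a b z′
      swap-cong {a} t {z} {z′} p = swap-word t (word a z′) (≋-trans (reach a z′) (≋-sym p))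

      swap-swap : ∀ {a b} → Transfers a b → ∀ z → swap a b (swap b a z) ≋ z
      swap-swap {a} {b} t z = ≋-trans (swap-word t (word b z) ≋-refl) (reach b z)

      α : Aut G
      α = record
        { to = swap x y ; from = swap y x
        ; to-cong = swap-cong xy ; from-cong = swap-cong yx
        ; to-r = λ i z → ≋-trans
            (swap-word xy (word x z ++ i ∷ [])
              (≋-trans (≋-reflexive (act-++ (word x z) _ x)) (r-cong G i (reach x z))))
            (≋-reflexive (act-++ (word x z) _ y))
        ; to-from = swap-swap xy ; from-to = swap-swap yx }

-- Parity of words and chirality.

data Even {A : Set} : List A → Set where
  []  : Even []
  ∷∷_ : ∀ {i j w} → Even w → Even (i ∷ j ∷ w)

even-or-odd : ∀ {A : Set} (w : List A) → Even w ⊎ Σ A λ i → Σ (List A) λ v → w ≡ i ∷ v × Even v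
even-or-odd []          = inj₁ []
even-or-odd (i ∷ [])    = inj₂ (i , [] , refl , [])
even-or-odd (i ∷ j ∷ w) with even-or-odd w
... | inj₁ e                  = inj₁ (∷∷ e)
... | inj₂ (h , v , refl , e) = inj₂ (i , j ∷ h ∷ v , refl , ∷∷ e)

module Chirality {n : ℕ} (G : Raw n) (pm : IsPremaniplex G) (chiral : IsChiral {G = G}) where

  open Graph G
  open IsPremaniplex pm
  open Involutive G r-invol
  open Connected G pm

  infix 4 _~_
  _~_ : Flag G → Flag G → Set
  _~_ = SameOrbit {G = G}

  adjacent-orbits : ∀ i x → ¬ x ~ r G i x
  adjacent-orbits = proj₂ chiral

  orbit-of : ∀ i x z → z ~ x ⊎ z ~ r G i x
  orbit-of i x z with proj₁ chiral
  ... | a , b , _ , ab with ab x | ab (r G i x) | ab z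
  ... | inj₁ p | inj₁ q | _      = ⊥-elim (adjacent-orbits i x (orbit-trans p (orbit-sym q)))
  ... | inj₂ p | inj₂ q | _      = ⊥-elim (adjacent-orbits i x (orbit-trans p (orbit-sym q)))
  ... | inj₁ p | inj₂ q | inj₁ s = inj₁ (orbit-trans s (orbit-sym p))
  ... | inj₁ p | inj₂ q | inj₂ s = inj₂ (orbit-trans s (orbit-sym q))
  ... | inj₂ p | inj₁ q | inj₂ s = inj₁ (orbit-trans s (orbit-sym p))
  ... | inj₂ p | inj₁ q | inj₁ s = inj₂ (orbit-trans s (orbit-sym q))

  -- Each colour exchanges the two orbits, so two steps lead back to the orbit of departure.
  orbit-even : ∀ {w} → Even w → ∀ x → x ~ act G w x
  orbit-even [] x = orbit-refl ≋-refl
  orbit-even (∷∷_ {i} {j} e) x with orbit-of i x (r G j (r G i x))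
  ... | inj₁ p = orbit-trans (orbit-sym p) (orbit-even e _)
  ... | inj₂ p = ⊥-elim (adjacent-orbits j (r G i x) (orbit-sym p))

  even-of-orbit : ∀ w {x y} → x ~ y → act G w x ≋ y → Even w
  even-of-orbit w {x} s p with even-or-odd w
  ... | inj₁ e                  = e
  ... | inj₂ (i , v , refl , e) = ⊥-elim (adjacent-orbits i x
          (orbit-trans s (orbit-trans (orbit-refl (≋-sym p)) (orbit-sym (orbit-even e (r G i x))))))

  -- Conjugation by colour `i` exchanges the stabilisers of `x` and `r G i x`, so one inclusion
  -- yields the other. Equal stabilisers would put adjacent flags in one orbit.
  not-reflexible : ∀ i x → ¬ (∀ w → act G w x ≋ x → act G w (r G i x) ≋ r G i x)
  not-reflexible i x t = adjacent-orbits i x (orbit-of-stabilisers t back)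
    where
      wrap : ∀ w z → act G (i ∷ w ++ i ∷ []) z ≡ r G i (act G w (r G i z))
      wrap w z = act-++ w (i ∷ []) (r G i z)

      back : ∀ w → act G w (r G i x) ≋ r G i x → act G w x ≋ x
      back w p = ≋-trans (act-cong w (≋-sym (r-invol i x)))
        (≋-trans (r-move i (≋-trans (≋-sym (≋-reflexive (wrap w (r G i x))))
                   (t (i ∷ w ++ i ∷ [])
                     (≋-trans (≋-reflexive (wrap w x)) (≋-trans (r-cong G i p) (r-invol i x))))))
                 (r-invol i x))

  -- Automorphisms transport commutation within an orbit, and it passes from `x` to `r G i x` by
  -- conjugation. These flags represent both orbits.
  comm-everywhere : ∀ i j x → r G i (r G j x) ≋ r G j (r G i x) →
                    ∀ z → r G i (r G j z) ≋ r G j (r G i z)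
  comm-everywhere i j x p z = by-orbit (orbit-of i x z)
    where
      transport : ∀ {y} → z ~ y → r G i (r G j y) ≋ r G j (r G i y) →
                  r G i (r G j z) ≋ r G j (r G i z)
      transport {y} (α , q) c = aut-injective α (begin
        act G (j ∷ i ∷ []) z · α    ≈⟨ act-aut α (j ∷ i ∷ []) z ⟩
        act G (j ∷ i ∷ []) (z · α)  ≈⟨ act-cong (j ∷ i ∷ []) q ⟩
        act G (j ∷ i ∷ []) y        ≈⟨ c ⟩
        act G (i ∷ j ∷ []) y        ≈⟨ act-cong (i ∷ j ∷ []) q ⟨
        act G (i ∷ j ∷ []) (z · α)  ≈⟨ act-aut α (i ∷ j ∷ []) z ⟨
        act G (i ∷ j ∷ []) z · α    ∎)
        where open ≋-Reasoning

      by-orbit : z ~ x ⊎ z ~ r G i x → r G i (r G j z) ≋ r G j (r G i z)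
      by-orbit (inj₁ s) = transport s p
      by-orbit (inj₂ s) = transport s
        (≋-trans (r-cong G i (≋-sym p)) (≋-trans (r-invol i _) (r-cong G j (≋-sym (r-invol i x)))))

-- Consequences of the diamond condition.

module Polytope {n : ℕ} (G : Raw n) (polytope : IsPolytope G) where

  open IsPolytope polytope
  open IsManiplex maniplex
  open IsPremaniplex premaniplex
  open Graph G
  open Involutive G r-invol

  faces-meet-trivially : ∀ (m l : Fin n) {x y} → toℕ m < toℕ l →
    PathIn G (λ j → toℕ j ≤ toℕ m) x y → PathIn G (λ j → toℕ l ≤ toℕ j) x y → x ≋ y
  faces-meet-trivially m l m<l p q =
    path-empty (λ j (l≤j , j≤m) → ℕₚ.<⇒≱ m<l (ℕₚ.≤-trans l≤j j≤m)) (diamond m l _ _ p q)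

  -- Otherwise the two ends of an edge of colour `e` would also be joined by colours from `e` + 1
  -- on, and the diamond condition would collapse the edge to a semi-edge.
  no-upper-path : ∀ e v → ¬ PathIn G (λ j → toℕ e < toℕ j) (r G e v) v
  no-upper-path e v ([] , _ , p) = noSemiEdge e v p
  -- The letter `j` above `e` guarantees that `e` + 1 is a colour.
  no-upper-path e v p@(j ∷ _ , e<j ∷ _ , _) = noSemiEdge e v
    (faces-meet-trivially e l (ℕₚ.≤-reflexive (≡.sym toℕ-l))
      (e ∷ [] , ℕₚ.≤-refl ∷ [] , r-invol e v)
      (path-weaken (λ {i} e<i → subst (_≤ toℕ i) (≡.sym toℕ-l) e<i) p))
    where
      e+1<n = ℕₚ.≤-<-trans e<j (Finₚ.toℕ<n j)
      l     = fromℕ< e+1<n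
      toℕ-l = Finₚ.toℕ-fromℕ< e+1<n

-- Stages of a Petrie step, and simplicity of Petrie polygons.

module PetrieWalk {m : ℕ} (P : Raw (suc m)) (polytope : IsPolytope P) where

  private n = suc m

  open IsPolytope polytope
  open IsManiplex maniplex
  open IsPremaniplex premaniplex
  open Graph P
  open Involutive P r-invol
  open Polytope P polytope

  colour : ℕ → Fin n
  colour s = s mod n

  toℕ-colour : ∀ {s} → s < n → toℕ (colour s) ≡ s
  toℕ-colour s<n = ≡.trans (Finₚ.toℕ-fromℕ< _) (m<n⇒m%n≡m s<n)

  colour-unique : ∀ {i s} → toℕ i ≡ s → colour s ≡ i
  colour-unique {i} refl = Finₚ.toℕ-injective (toℕ-colour (Finₚ.toℕ<n i))

  -- A Petrie step cut into single reflections: stage `s` has applied the first `s` colours, and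
  -- stage `n` is the whole step.
  walk : ℕ → Flag P → Flag P
  walk zero    z = z
  walk (suc s) z = r P (colour s) (walk s z)

  walk-cong : ∀ s {x y} → x ≋ y → walk s x ≋ walk s y
  walk-cong zero    p = p
  walk-cong (suc s) p = r-cong P (colour s) (walk-cong s p)

  unwalk : ℕ → Flag P → Flag P
  unwalk zero    z = z
  unwalk (suc s) z = unwalk s (r P (colour s) z)

  walk-unwalk : ∀ s z → walk s (unwalk s z) ≋ z
  walk-unwalk zero    z = ≋-refl
  walk-unwalk (suc s) z = ≋-trans (r-cong P (colour s) (walk-unwalk s _)) (r-invol (colour s) z)

  walk-injective : ∀ s {x y} → walk s x ≋ walk s y → x ≋ y
  walk-injective zero    p = p
  walk-injective (suc s) p =
    walk-injective s (≋-trans (r-move (colour s) p) (r-invol (colour s) _))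

  run : ℕ → ℕ → List (Fin n)
  run s zero    = []
  run s (suc d) = colour s ∷ run (suc s) d

  run-walk : ∀ s d z → act P (run s d) (walk s z) ≡ walk (s + d) z
  run-walk s zero    z = cong (λ t → walk t z) (≡.sym (ℕₚ.+-identityʳ s))
  run-walk s (suc d) z =
    ≡.trans (run-walk (suc s) d z) (cong (λ t → walk t z) (≡.sym (ℕₚ.+-suc s d)))

  run-colours : ∀ s d → s + d ≤ n → All (λ j → s ≤ toℕ j) (run s d)
  run-colours s zero    _ = []
  run-colours s (suc d) b = ℕₚ.≤-reflexive (≡.sym (toℕ-colour (ℕₚ.≤-trans (s≤s (ℕₚ.m≤m+n s d)) b′))) ∷
      All.map ℕₚ.<⇒≤ (run-colours (suc s) d b′)
    where b′ = subst (_≤ n) (ℕₚ.+-suc s d) b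

  run-not-closed : ∀ s d {y} → s + suc d ≤ n → ¬ act P (run s (suc d)) y ≋ y
  run-not-closed s d {y} b p = no-upper-path (colour s) y (run (suc s) d ,
      subst (λ u → All (λ j → u < toℕ j) (run (suc s) d)) (≡.sym (toℕ-colour s<n)) (run-colours (suc s) d b′) , p)
    where
      b′ = subst (_≤ n) (ℕₚ.+-suc s d) b
      s<n = ℕₚ.≤-trans (s≤s (ℕₚ.m≤m+n s d)) b′

  walk-path : ∀ s t z → s ≤ t → t ≤ n → PathIn P (λ j → s ≤ toℕ j) (walk s z) (walk t z)
  walk-path s t z s≤t t≤n = run s (t ∸ s) , run-colours s (t ∸ s) (subst (_≤ n) (≡.sym s+) t≤n) ,
      ≋-reflexive (≡.trans (run-walk s (t ∸ s) z) (cong (λ u → walk u z) s+))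
    where s+ = ℕₚ.m+[n∸m]≡n s≤t

  tabulate-run : ∀ d s (f : Fin d → Fin n) → (∀ i → toℕ (f i) ≡ s + toℕ i) → tabulate f ≡ run s d
  tabulate-run zero    s f p = refl
  tabulate-run (suc d) s f p = cong₂ _∷_
    (≡.sym (colour-unique (≡.trans (p Fin.zero) (ℕₚ.+-identityʳ s))))
    (tabulate-run d (suc s) (λ i → f (Fin.suc i)) (λ i → ≡.trans (p (Fin.suc i)) (ℕₚ.+-suc s (toℕ i))))

  petrie-walk : ∀ z → petrie P z ≡ walk n z
  petrie-walk z = ≡.trans (cong (λ w → act P w z) (tabulate-run n 0 (λ i → i) (λ _ → refl)))
                          (run-walk 0 n z)

  petrie-cong : ∀ {x y} → x ≋ y → petrie P x ≋ petrie P y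
  petrie-cong = act-cong (allFin n)

  petrie-injective : ∀ {x y} → petrie P x ≋ petrie P y → x ≋ y
  petrie-injective = act-injective (allFin n)

  iter-cong : ∀ a {x y} → x ≋ y → iter P a x ≋ iter P a y
  iter-cong zero    p = p
  iter-cong (suc a) p = petrie-cong (iter-cong a p)

  iter-+ : ∀ a b x → iter P (a + b) x ≡ iter P a (iter P b x)
  iter-+ zero    b x = refl
  iter-+ (suc a) b x = cong (petrie P) (iter-+ a b x)

  iter-injective : ∀ a {x y} → iter P a x ≋ iter P a y → x ≋ y
  iter-injective zero    p = p
  iter-injective (suc a) p = iter-injective a (petrie-injective p)

  infix 4 _∼_
  -- A form of `SamePetrie` that is symmetric and composes by adding exponents. Injectivity of
  -- `petrie` later cancels the smaller exponent.
  _∼_ : Flag P → Flag P → Set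
  x ∼ y = Σ ℕ λ a → Σ ℕ λ b → iter P a x ≋ iter P b y

  ∼-refl : ∀ {x y} → x ≋ y → x ∼ y
  ∼-refl p = 0 , 0 , p

  ∼-petrie : ∀ {x y} → petrie P x ≋ y → x ∼ y
  ∼-petrie p = 1 , 0 , p

  ∼-sym : ∀ {x y} → x ∼ y → y ∼ x
  ∼-sym (a , b , p) = b , a , ≋-sym p

  ∼-trans : ∀ {x y z} → x ∼ y → y ∼ z → x ∼ z
  ∼-trans {x} {y} {z} (a , b , p) (c , d , q) = c + a , b + d , (begin
    iter P (c + a) x         ≡⟨ iter-+ c a x ⟩
    iter P c (iter P a x)    ≈⟨ iter-cong c p ⟩
    iter P c (iter P b y)    ≡⟨ iter-+ c b y ⟨
    iter P (c + b) y         ≡⟨ cong (λ t → iter P t y) (ℕₚ.+-comm c b) ⟩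
    iter P (b + c) y         ≡⟨ iter-+ b c y ⟩
    iter P b (iter P c y)    ≈⟨ iter-cong b q ⟩
    iter P b (iter P d z)    ≡⟨ iter-+ b d z ⟨
    iter P (b + d) z         ∎)
    where open ≋-Reasoning

  ∼⇒SamePetrie : ∀ {x y} → x ∼ y → SamePetrie P x y
  ∼⇒SamePetrie {x} {y} (a , b , p) with ℕₚ.≤-total a b
  ... | inj₁ a≤b = b ∸ a , inj₂ (iter-injective a (begin
    iter P a (iter P (b ∸ a) y)  ≡⟨ iter-+ a (b ∸ a) y ⟨
    iter P (a + (b ∸ a)) y       ≡⟨ cong (λ t → iter P t y) (ℕₚ.m+[n∸m]≡n a≤b) ⟩
    iter P b y                   ≈⟨ p ⟨
    iter P a x                   ∎))
    where open ≋-Reasoning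
  ... | inj₂ b≤a = a ∸ b , inj₁ (iter-injective b (begin
    iter P b (iter P (a ∸ b) x)  ≡⟨ iter-+ b (a ∸ b) x ⟨
    iter P (b + (a ∸ b)) x       ≡⟨ cong (λ t → iter P t x) (ℕₚ.m+[n∸m]≡n b≤a) ⟩
    iter P a x                   ≈⟨ p ⟩
    iter P b y                   ∎))
    where open ≋-Reasoning

  infix 4 _≈ᵥ_
  _≈ᵥ_ : Flag P → Flag P → Set
  _≈ᵥ_ = SameFace P Fin.zero

  upper⇒≈ᵥ : ∀ {s x y} → 1 ≤ s → PathIn P (λ j → s ≤ toℕ j) x y → x ≈ᵥ y
  upper⇒≈ᵥ 1≤s = path-weaken (λ { s≤j refl → ℕₚ.<⇒≱ (ℕₚ.≤-trans 1≤s s≤j) z≤n })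

  walk≈ᵥpetrie : ∀ s z → suc s ≤ n → walk (suc s) z ≈ᵥ petrie P z
  walk≈ᵥpetrie s z s<n = path-trans (upper⇒≈ᵥ (s≤s z≤n) (walk-path (suc s) n z s<n ℕₚ.≤-refl))
                                    (path-refl (≋-reflexive (≡.sym (petrie-walk z))))

  walk-distinct : ∀ {s t z} → s < t → t ≤ n → ¬ walk s z ≋ walk t z
  walk-distinct {s} {t} {z} s<t t≤n p = no-upper-path (colour s) (walk s z)
    (path-trans (path-weaken (λ {j} → subst (λ u → u < toℕ j) (≡.sym (toℕ-colour (ℕₚ.<-≤-trans s<t t≤n))))
                             (walk-path (suc s) t z s<t t≤n))
                (path-refl (≋-sym p)))

  module _ (simple : SimplePetriePolygons P)
           (r₀-comm : ∀ i → 2 ≤ toℕ i → ∀ x →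
                      r P Fin.zero (r P i x) ≋ r P i (r P Fin.zero x)) where

    private
      r₀ = r P Fin.zero

      -- Simplicity only refutes that two flags are distinct, and `≋` comes without a decision
      -- procedure, so the equality is available only on the way to a contradiction.
      identify : ∀ {x y} → x ∼ y → x ≈ᵥ y → (x ≋ y → ⊥) → ⊥
      identify p q x≉y = simple _ _ (∼⇒SamePetrie p) x≉y q

    -- From stage 1 on a round stays in one vertex, so both rounds end in the same vertex.
    -- Simplicity identifies `z` with `z′`, and the stages of a single round are distinct.
    same-walk-end : ∀ {z z′ f f′} → f < m → f′ < m → z ∼ z′ →
                    walk (suc f) z ≋ walk (suc f′) z′ → f ≢ f′ → ⊥
    same-walk-end {z} {z′} {f} {f′} f<m f′<m z∼z′ p f≢f′ =
      identify {petrie P z} {petrie P z′} (∼-trans (∼-sym (∼-petrie ≋-refl)) (∼-trans z∼z′ (∼-petrie ≋-refl)))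
        (path-trans (path-sym (walk≈ᵥpetrie f z (s≤s (ℕₚ.<⇒≤ f<m))))
          (path-trans (path-refl p) (walk≈ᵥpetrie f′ z′ (s≤s (ℕₚ.<⇒≤ f′<m)))))
        λ q → compare (≋-trans p (walk-cong (suc f′) (≋-sym (petrie-injective q))))
      where
        compare : walk (suc f) z ≋ walk (suc f′) z → ⊥
        compare q with ℕₚ.<-cmp f f′
        ... | tri< f<f′ _ _ = walk-distinct (s≤s f<f′) (s≤s (ℕₚ.<⇒≤ f′<m)) q
        ... | tri≈ _ f≡f′ _ = f≢f′ f≡f′
        ... | tri> _ _ f′<f = walk-distinct (s≤s f′<f) (s≤s (ℕₚ.<⇒≤ f<m)) (≋-sym q)

    private
      -- From stage 2 on the remaining colours commute with `r₀`. Completing the round of `z′`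
      -- therefore leads to `r₀ W`, which is stage 1 of the following round, without leaving the
      -- vertex. Simplicity then identifies `z` with `W`.
      later-end : ∀ {z z′ f f′} → f < m → suc f′ < m → z ∼ z′ →
                  ¬ walk (suc f) z ≋ r₀ (walk (suc (suc f′)) z′)
      later-end {z} {z′} {f} {f′} f<m f′<m z∼z′ p =
        identify {petrie P z} {petrie P W}
          (∼-trans (∼-sym (∼-petrie ≋-refl)) (∼-trans z∼z′ (∼-trans (∼-petrie ≋-refl) (∼-petrie ≋-refl))))
          (path-trans (path-sym (walk≈ᵥpetrie f z (s≤s (ℕₚ.<⇒≤ f<m))))
            (path-trans (upper⇒≈ᵥ {s = 2} (s≤s z≤n) (path-weaken 2≤ (w , w-colours , end)))
              (walk≈ᵥpetrie 0 W (s≤s z≤n))))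
          (λ q → clash f f<m (≋-trans end (r-cong P Fin.zero (≋-sym (petrie-injective q)))))
        where
          W = petrie P z′
          s = suc (suc f′)
          d = n ∸ suc s
          s+1+d≡n = ≡.trans (ℕₚ.+-suc s d) (ℕₚ.m+[n∸m]≡n (s≤s f′<m))
          w = run s (suc d)
          w-colours = run-colours s (suc d) (ℕₚ.≤-reflexive s+1+d≡n)

          2≤ : ∀ {j : Fin n} → s ≤ toℕ j → 2 ≤ toℕ j
          2≤ = ℕₚ.≤-trans (s≤s (s≤s z≤n))

          end : act P w (walk (suc f) z) ≋ r₀ W
          end = begin
            act P w (walk (suc f) z)    ≈⟨ act-cong w p ⟩
            act P w (r₀ (walk s z′))    ≈⟨ act-comm Fin.zero r₀-comm (All.map 2≤ w-colours) _ ⟨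
            r₀ (act P w (walk s z′))    ≡⟨ cong r₀ (run-walk s (suc d) z′) ⟩
            r₀ (walk (s + suc d) z′)    ≡⟨ cong (λ t → r₀ (walk t z′)) s+1+d≡n ⟩
            r₀ (walk n z′)              ≡⟨ cong r₀ (petrie-walk z′) ⟨
            r₀ W                        ∎
            where open ≋-Reasoning

          -- Once `z` is `W`, colours from `s` on join stage `suc f` of `z` to stage 1. For `f` = 0
          -- this closes a run of increasing colours; otherwise it leads from stage 2 back to stage
          -- 1 by colours above 1.
          clash : ∀ f → f < m → act P w (walk (suc f) z) ≋ r₀ z → ⊥
          clash zero    _   q = run-not-closed s d (ℕₚ.≤-reflexive s+1+d≡n) q
          clash (suc f) f<m q = no-upper-path (colour 1) (r₀ z)
            (path-weaken (λ {j} → subst (λ u → u < toℕ j) (≡.sym (toℕ-colour 1<n)))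
              (path-trans (walk-path 2 (suc (suc f)) z (s≤s (s≤s z≤n)) (s≤s (ℕₚ.<⇒≤ f<m)))
                          (path-weaken 2≤ (w , w-colours , q))))
            where 1<n = s≤s (ℕₚ.≤-trans (s≤s z≤n) f<m)

    opposite-walk-end : ∀ {z z′ f f′} → f < m → f′ < m → z ∼ z′ →
                        ¬ walk (suc f) z ≋ r₀ (walk (suc f′) z′)
    opposite-walk-end {f′ = suc f′} f<m f′<m z∼z′ p = later-end f<m f′<m z∼z′ p
    opposite-walk-end {f = suc f} {zero} f<m f′<m z∼z′ p =
      later-end f′<m f<m (∼-sym z∼z′) (≋-sym (≋-trans (r-cong P _ p) (r-invol _ _)))
    -- Here `z′` is `r₀ z`, stage 1 of the round of `z`. Simplicity makes it `petrie P z`, stage `n`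
    -- of that round, and these two stages differ.
    opposite-walk-end {z} {z′} {zero} {zero} f<m _ z∼z′ p =
      identify {z} {petrie P z′} (∼-trans z∼z′ (∼-petrie ≋-refl))
        (path-trans (path-refl (r-move Fin.zero z′≋)) (walk≈ᵥpetrie 0 z′ (s≤s z≤n)))
        λ _ → identify {z′} {petrie P z} (∼-trans (∼-sym z∼z′) (∼-petrie ≋-refl))
          (path-trans (path-refl (≋-sym z′≋)) (walk≈ᵥpetrie 0 z (s≤s z≤n)))
          λ q → walk-distinct (s≤s f<m) ℕₚ.≤-refl
            (≋-trans z′≋ (≋-trans q (≋-reflexive (petrie-walk z))))
      where
        z′≋ : r₀ z ≋ z′
        z′≋ = ≋-trans p (r-invol Fin.zero z′)

-- Neither r₀, r₁ nor r₁, r₂ commute at a flag of a chiral polytope.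

module Irreducible {m : ℕ} (P : Raw (3 + m)) (polytope : IsPolytope P)
                   (chiral : IsChiral {G = P}) where

  open IsPolytope polytope
  open IsManiplex maniplex
  open IsPremaniplex premaniplex
  open Graph P
  open Involutive P r-invol
  open Polytope P polytope
  open Chirality P premaniplex chiral


  private
    r₀ = r P 0F
    r₁ = r P 1F

  r₀-comm : ∀ i → 2 ≤ toℕ i → ∀ x → r₀ (r P i x) ≋ r P i (r₀ x)
  r₀-comm (2+ i) _         x = comm-of-closed 0F (2+ i) x (r-comm 0F (2+ i) (s≤s (s≤s z≤n)) x)
  r₀-comm 1F     (s≤s ())  x

  -- `r₀` would commute with every colour, so each word fixing `x` would fix `r₀ x` as well.
  no-comm₀₁ : ∀ x → ¬ r₀ (r₁ x) ≋ r₁ (r₀ x)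
  no-comm₀₁ x c = not-reflexible 0F x λ w p →
    ≋-trans (≋-sym (act-comm {Q = λ _ → ⊤} 0F (λ i _ → central i) (All.universal _ w) x)) (r-cong P 0F p)
    where
      central : ∀ i z → r₀ (r P i z) ≋ r P i (r₀ z)
      central 0F     z = ≋-refl
      central 1F     z = comm-everywhere 0F 1F x c z
      central (2+ i) z = r₀-comm (2+ i) (s≤s (s≤s z≤n)) z

  private
    Low High : Fin (3 + m) → Set
    Low  i = toℕ i ≤ 1
    High i = 2 ≤ toℕ i

    ρ ρ⁻¹ : Flag P → Flag P
    ρ   z = r₁ (r₀ z)
    ρ⁻¹ z = r₀ (r₁ z)

    ρρ⁻¹ : ∀ z → ρ (ρ⁻¹ z) ≋ z
    ρρ⁻¹ z = ≋-trans (r-cong P 1F (r-invol 0F _)) (r-invol 1F z)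

    ρ⁻¹ρ : ∀ z → ρ⁻¹ (ρ z) ≋ z
    ρ⁻¹ρ z = ≋-trans (r-cong P 0F (r-invol 1F _)) (r-invol 0F z)

    ρ-cong : ∀ {x y} → x ≋ y → ρ x ≋ ρ y
    ρ-cong p = act-cong (0F ∷ 1F ∷ []) p

    ρ⁻¹-cong : ∀ {x y} → x ≋ y → ρ⁻¹ x ≋ ρ⁻¹ y
    ρ⁻¹-cong p = act-cong (1F ∷ 0F ∷ []) p

    -- This makes every even word in colours 0 and 1 a product of rotations `ρ` and `ρ⁻¹`.
    low-pair : ∀ i j → Low i → Low j →
      (∀ z → r P j (r P i z) ≋ z) ⊎ (∀ z → r P j (r P i z) ≋ ρ z) ⊎ (∀ z → r P j (r P i z) ≋ ρ⁻¹ z)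
    low-pair 0F     0F     _ _ = inj₁ (r-invol 0F)
    low-pair 0F     1F     _ _ = inj₂ (inj₁ (λ _ → ≋-refl))
    low-pair 1F     0F     _ _ = inj₂ (inj₂ (λ _ → ≋-refl))
    low-pair 1F     1F     _ _ = inj₁ (r-invol 1F)
    low-pair (2+ _) _      (s≤s ()) _
    low-pair 0F     (2+ _) _ (s≤s ())
    low-pair 1F     (2+ _) _ (s≤s ())

    even-ρ : ∀ {w} → Even w → All Low w → ∀ z → act P w (ρ z) ≋ ρ (act P w z)
    even-ρ [] [] z = ≋-refl
    even-ρ (∷∷_ {i} {j} {w} e) (li ∷ lj ∷ ls) z =
      ≋-trans (act-cong w (pair (low-pair i j li lj))) (even-ρ e ls _)
      where
        pair : _ → r P j (r P i (ρ z)) ≋ ρ (r P j (r P i z))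
        pair (inj₁ c)        = ≋-trans (c _) (ρ-cong (≋-sym (c z)))
        pair (inj₂ (inj₁ c)) = ≋-trans (c _) (ρ-cong (≋-sym (c z)))
        pair (inj₂ (inj₂ c)) = ≋-trans (c _) (≋-trans (ρ⁻¹ρ z)
                                 (≋-trans (≋-sym (ρρ⁻¹ z)) (ρ-cong (≋-sym (c z)))))

    even-ρ⁻¹ : ∀ {w} → Even w → All Low w → ∀ z → act P w (ρ⁻¹ z) ≋ ρ⁻¹ (act P w z)
    even-ρ⁻¹ {w} e ls z = ≋-trans (≋-sym (ρ⁻¹ρ _))
      (ρ⁻¹-cong (≋-trans (≋-sym (even-ρ e ls (ρ⁻¹ z))) (act-cong w (ρρ⁻¹ z))))

    -- The odd word w r₀ of the dihedral group ⟨r₀ , r₁⟩ is an involution.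
    even-low-reflect : ∀ {w} → Even w → All Low w → ∀ z → act P w (r₀ (act P w z)) ≋ r₀ z
    even-low-reflect [] [] z = ≋-refl
    even-low-reflect (∷∷_ {i} {j} {w} e) (li ∷ lj ∷ ls) z = step (low-pair i j li lj)
      where
        open ≋-Reasoning
        q : Flag P → Flag P
        q y = r P j (r P i y)

        finish : q (r₀ (act P w (q z))) ≋ r₀ (act P w z) → act P w (q (r₀ (act P w (q z)))) ≋ r₀ z
        finish p = ≋-trans (act-cong w p) (even-low-reflect e ls z)

        step : _ → act P w (q (r₀ (act P w (q z)))) ≋ r₀ z
        step (inj₁ c) = finish (≋-trans (c _) (r-cong P 0F (act-cong w (c z))))
        step (inj₂ (inj₁ c)) = finish (begin
          q (r₀ (act P w (q z)))       ≈⟨ c _ ⟩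
          r₁ (r₀ (r₀ (act P w (q z)))) ≈⟨ r-cong P 1F (r-invol 0F _) ⟩
          r₁ (act P w (q z))           ≈⟨ r-cong P 1F (act-cong w (c z)) ⟩
          r₁ (act P w (ρ z))           ≈⟨ r-cong P 1F (even-ρ e ls z) ⟩
          r₁ (r₁ (r₀ (act P w z)))     ≈⟨ r-invol 1F _ ⟩
          r₀ (act P w z)               ∎)
        step (inj₂ (inj₂ c)) = finish (begin
          q (r₀ (act P w (q z)))            ≈⟨ c _ ⟩
          r₀ (r₁ (r₀ (act P w (q z))))      ≈⟨ act-cong (0F ∷ 1F ∷ 0F ∷ []) (act-cong w (c z)) ⟩
          r₀ (r₁ (r₀ (act P w (ρ⁻¹ z))))    ≈⟨ act-cong (0F ∷ 1F ∷ 0F ∷ []) (even-ρ⁻¹ e ls z) ⟩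
          r₀ (ρ (ρ⁻¹ (act P w z)))          ≈⟨ r-cong P 0F (ρρ⁻¹ _) ⟩
          r₀ (act P w z)                    ∎)

    module _ (comm : ∀ i j → Low i → High j → ∀ z → r P i (r P j z) ≋ r P j (r P i z)) where

      split : ∀ w → Σ (List (Fin (3 + m))) λ l → Σ (List (Fin (3 + m))) λ h →
              All Low l × All High h × (∀ z → act P w z ≋ act P h (act P l z))
      split [] = [] , [] , [] , [] , λ _ → ≋-refl
      split (i ∷ w) with split w | toℕ i ℕ.≤? 1
      ... | l , h , ll , hh , p | yes li = i ∷ l , h , li ∷ ll , hh , λ z → p (r P i z)
      ... | l , h , ll , hh , p | no ¬li = l , i ∷ h , ll , ℕₚ.≰⇒> ¬li ∷ hh , λ z →
        ≋-trans (p (r P i z)) (act-cong h (≋-sym (act-comm {Q = Low} i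
          (λ j lj x → ≋-sym (comm j i lj (ℕₚ.≰⇒> ¬li) x)) ll z)))

      -- The low and the high part of `w` each fix `x`, because the faces they move in meet only
      -- there. The high part commutes with `r₀`. The low part is even by chirality, hence a
      -- rotation, and `r₀` inverts rotations.
      reflect : ∀ x w → act P w x ≋ x → act P w (r₀ x) ≋ r₀ x
      reflect x w p with split w
      ... | l , h , ll , hh , f = begin
        act P w (r₀ x)            ≈⟨ f (r₀ x) ⟩
        act P h (act P l (r₀ x))  ≈⟨ act-cong h low-part ⟩
        act P h (r₀ x)            ≈⟨ act-comm 0F r₀-comm hh x ⟨
        r₀ (act P h x)            ≈⟨ r-cong P 0F high-fixes ⟩
        r₀ x                      ∎
        where
          open ≋-Reasoning
          hl-fixes = ≋-trans (≋-sym (f x)) p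

          low-fixes : act P l x ≋ x
          low-fixes = ≋-sym (faces-meet-trivially 1F 2F ℕₚ.≤-refl (l , ll , ≋-refl)
                              (path-sym (h , hh , hl-fixes)))

          high-fixes : act P h x ≋ x
          high-fixes = ≋-trans (act-cong h (≋-sym low-fixes)) hl-fixes

          low-part : act P l (r₀ x) ≋ r₀ x
          low-part = ≋-trans (act-cong l (r-cong P 0F (≋-sym low-fixes)))
            (even-low-reflect (even-of-orbit l (orbit-refl ≋-refl) low-fixes) ll x)

  -- If r₁ and r₂ commute, the monodromy group is the direct product of
  -- ⟨r₀ , r₁⟩ and ⟨r₂ , … ⟩, and the dihedral factor always admits a reflection.
  no-comm₁₂ : ∀ x → ¬ r₁ (r P 2F x) ≋ r P 2F (r₁ x)
  no-comm₁₂ x c = not-reflexible 0F x (reflect comm x)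
    where
      comm : ∀ i j → Low i → High j → ∀ z → r P i (r P j z) ≋ r P j (r P i z)
      comm 0F j _ hj z = r₀-comm j hj z
      comm 1F 0F _ () z
      comm 1F 1F _ (s≤s ()) z
      comm 1F 2F _ _ z = comm-everywhere 1F 2F x c z
      comm 1F (2+ (Fin.suc j)) _ _ z = comm-of-closed 1F _ z (r-comm 1F (2+ (Fin.suc j)) (s≤s (s≤s z≤n)) z)
      comm (2+ _) j (s≤s ()) _ z

-- Arithmetic of the 4k-gon and of its opposite sides.

module Polygon (k : ℕ) where

  open Family2 k

  K N : ℕ
  K = 2 * k
  N = K + K


  -- side h j is e_j for h = false and e_{j+2k} for h = true, so that r2 flips h.
  side : Bool → Fin K → Side
  side false j = j ↑ˡ K
  side true  j = K ↑ʳ j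

  data SideView : Side → Set where
    mk : ∀ h j → SideView (side h j)

  side-view : ∀ i → SideView i
  side-view i with splitAt K i | Finₚ.join-splitAt K K i
  ... | inj₁ j | refl = mk false j
  ... | inj₂ j | refl = mk true j

  side-injective : ∀ h {j j′} → side h j ≡ side h j′ → j ≡ j′
  side-injective false p = Finₚ.↑ˡ-injective K _ _ p
  side-injective true  p = Finₚ.↑ʳ-injective K _ _ p

  side-≢ : ∀ h {j j′} → side h j ≢ side (not h) j′
  side-≢ false {j} {j′} p with ≡.trans (≡.sym (Finₚ.splitAt-↑ˡ K j K))
                                (≡.trans (cong (splitAt K) p) (Finₚ.splitAt-↑ʳ K K j′))
  ... | ()
  side-≢ true {j} {j′} p with ≡.trans (≡.sym (Finₚ.splitAt-↑ʳ K K j))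
                               (≡.trans (cong (splitAt K) p) (Finₚ.splitAt-↑ˡ K j′ K))
  ... | ()

  module _ .{{_ : ℕ.NonZero N}} where

    rotate : ℕ → Side → Side
    rotate zero    i = i
    rotate (suc a) i = cycSuc (rotate a i)

    toℕ-rotate : ∀ a i → toℕ (rotate a i) ≡ (toℕ i + a) % N
    toℕ-rotate zero    i = ≡.sym (≡.trans (cong (_% N) (ℕₚ.+-identityʳ _)) (m<n⇒m%n≡m (Finₚ.toℕ<n i)))
    toℕ-rotate (suc a) i = begin
      toℕ (cycSuc (rotate a i))            ≡⟨ Finₚ.toℕ-fromℕ< _ ⟩
      suc (toℕ (rotate a i)) % N           ≡⟨ cong (λ t → suc t % N) (toℕ-rotate a i) ⟩
      (1 + b % N) % N                      ≡⟨ %-distribˡ-+ 1 (b % N) N ⟩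
      (1 % N + b % N % N) % N              ≡⟨ cong (λ t → (1 % N + t) % N) (m%n%n≡m%n b N) ⟩
      (1 % N + b % N) % N                  ≡⟨ %-distribˡ-+ 1 b N ⟨
      (1 + b) % N                          ≡⟨ cong (_% N) (ℕₚ.+-suc (toℕ i) a) ⟨
      (toℕ i + suc a) % N                  ∎
      where
        open ≡.≡-Reasoning
        b = toℕ i + a

    rotate-unique : ∀ a i {s} → (toℕ i + a) % N ≡ toℕ s → rotate a i ≡ s
    rotate-unique a i p = Finₚ.toℕ-injective (≡.trans (toℕ-rotate a i) p)

    rotate-unique-< : ∀ a i {s} → toℕ i + a ≡ toℕ s → rotate a i ≡ s
    rotate-unique-< a i {s} p = rotate-unique a i
      (≡.trans (cong (_% N) p) (m<n⇒m%n≡m (Finₚ.toℕ<n s)))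

    rotate-unique-≥ : ∀ a i {s} → toℕ i + a ≡ toℕ s + N → rotate a i ≡ s
    rotate-unique-≥ a i {s} p = rotate-unique a i
      (≡.trans (cong (_% N) p) (≡.trans ([m+n]%n≡m%n (toℕ s) N) (m<n⇒m%n≡m (Finₚ.toℕ<n s))))

    rotate-+ : ∀ a b i → rotate (a + b) i ≡ rotate a (rotate b i)
    rotate-+ zero    b i = refl
    rotate-+ (suc a) b i = cong cycSuc (rotate-+ a b i)

    rotate-N : ∀ i → rotate N i ≡ i
    rotate-N i = rotate-unique-≥ N i refl

    cycPred-rotate : ∀ i → cycPred i ≡ rotate (N ∸ 1) i
    cycPred-rotate i = Finₚ.toℕ-injective
      (≡.trans (Finₚ.toℕ-fromℕ< _) (≡.sym (toℕ-rotate (N ∸ 1) i)))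

    1+N∸1 : 1 + (N ∸ 1) ≡ N
    1+N∸1 = ℕₚ.m+[n∸m]≡n (ℕ.>-nonZero⁻¹ N)

    cycSuc-cycPred : ∀ i → cycSuc (cycPred i) ≡ i
    cycSuc-cycPred i = ≡.trans (cong cycSuc (cycPred-rotate i))
      (≡.trans (cong (λ a → rotate a i) 1+N∸1) (rotate-N i))

    cycPred-cycSuc : ∀ i → cycPred (cycSuc i) ≡ i
    cycPred-cycSuc i = ≡.trans (cycPred-rotate (cycSuc i))
      (≡.trans (≡.sym (rotate-+ (N ∸ 1) 1 i))
        (≡.trans (cong (λ a → rotate a i) (≡.trans (ℕₚ.+-comm (N ∸ 1) 1) 1+N∸1)) (rotate-N i)))

    rotate-K : ∀ h j → rotate K (side h j) ≡ side (not h) j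
    rotate-K false j = rotate-unique-< K (side false j)
      (≡.trans (cong (_+ K) (Finₚ.toℕ-↑ˡ j K)) (≡.trans (ℕₚ.+-comm (toℕ j) K) (≡.sym (Finₚ.toℕ-↑ʳ K j))))
    rotate-K true j = rotate-unique-≥ K (side true j) (begin
      toℕ (K ↑ʳ j) + K    ≡⟨ cong (_+ K) (Finₚ.toℕ-↑ʳ K j) ⟩
      K + toℕ j + K       ≡⟨ cong (_+ K) (ℕₚ.+-comm K (toℕ j)) ⟩
      toℕ j + K + K       ≡⟨ ℕₚ.+-assoc (toℕ j) K K ⟩
      toℕ j + N           ≡⟨ cong (_+ N) (Finₚ.toℕ-↑ˡ j K) ⟨
      toℕ (j ↑ˡ K) + N    ∎)
      where open ≡.≡-Reasoning

    rotate-from-origin : ∀ h h′ {o} j → toℕ o ≡ 0 → rotate (toℕ (side h′ j)) (side h o) ≡ side (h xor h′) j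
    rotate-from-origin false h′ {o} j p = rotate-unique-< _ (side false o)
      (cong (_+ toℕ (side h′ j)) (≡.trans (Finₚ.toℕ-↑ˡ o K) p))
    rotate-from-origin true h′ {o} j p = ≡.trans (cong (rotate a) (≡.sym (rotate-K false o)))
      (≡.trans (≡.sym (rotate-+ a K _)) (≡.trans (cong (λ t → rotate t (side false o)) (ℕₚ.+-comm a K))
        (≡.trans (rotate-+ K a _) (≡.trans (cong (rotate K) (rotate-from-origin false h′ j p)) (rotate-K h′ j)))))
      where a = toℕ (side h′ j)

    cycSuc-inner : ∀ h {j j′} → toℕ j′ ≡ suc (toℕ j) → cycSuc (side h j) ≡ side h j′
    cycSuc-inner false {j} {j′} p = rotate-unique-< 1 (side false j)
      (≡.trans (cong (_+ 1) (Finₚ.toℕ-↑ˡ j K)) (≡.trans (ℕₚ.+-comm (toℕ j) 1)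
        (≡.trans (≡.sym p) (≡.sym (Finₚ.toℕ-↑ˡ j′ K)))))
    cycSuc-inner true {j} {j′} p = rotate-unique-< 1 (side true j)
      (≡.trans (cong (_+ 1) (Finₚ.toℕ-↑ʳ K j)) (≡.trans (ℕₚ.+-assoc K (toℕ j) 1)
        (≡.trans (cong (K +_) (≡.trans (ℕₚ.+-comm (toℕ j) 1) (≡.sym p))) (≡.sym (Finₚ.toℕ-↑ʳ K j′)))))

    cycSuc-last : ∀ h {j o} → suc (toℕ j) ≡ K → toℕ o ≡ 0 → cycSuc (side h j) ≡ side (not h) o
    cycSuc-last false {j} {o} p q = rotate-unique-< 1 (side false j)
      (≡.trans (cong (_+ 1) (Finₚ.toℕ-↑ˡ j K)) (≡.trans (ℕₚ.+-comm (toℕ j) 1) (≡.trans p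
        (≡.trans (≡.sym (ℕₚ.+-identityʳ K)) (≡.trans (cong (K +_) (≡.sym q)) (≡.sym (Finₚ.toℕ-↑ʳ K o)))))))
    cycSuc-last true {j} {o} p q = rotate-unique-≥ 1 (side true j)
      (≡.trans (cong (_+ 1) (Finₚ.toℕ-↑ʳ K j)) (≡.trans (ℕₚ.+-assoc K (toℕ j) 1)
        (≡.trans (cong (K +_) (≡.trans (ℕₚ.+-comm (toℕ j) 1) p))
          (cong (_+ N) (≡.sym (≡.trans (Finₚ.toℕ-↑ˡ o K) q))))))

    next-side : ∀ h j → (Σ (Fin K) λ j′ → toℕ j′ ≡ suc (toℕ j) × cycSuc (side h j) ≡ side h j′)
              ⊎ (suc (toℕ j) ≡ K × ∀ o → toℕ o ≡ 0 → cycSuc (side h j) ≡ side (not h) o)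
    next-side h j with ℕₚ.m≤n⇒m<n∨m≡n (Finₚ.toℕ<n j)
    ... | inj₁ j+1<K = inj₁ (fromℕ< j+1<K , Finₚ.toℕ-fromℕ< j+1<K , cycSuc-inner h (Finₚ.toℕ-fromℕ< j+1<K))
    ... | inj₂ j+1≡K = inj₂ (j+1≡K , λ o → cycSuc-last h j+1≡K)

    unrotate : ℕ → Side → Side
    unrotate zero    i = i
    unrotate (suc a) i = cycPred (unrotate a i)

    unrotate-cycSuc : ∀ a i → unrotate a (cycSuc i) ≡ cycSuc (unrotate a i)
    unrotate-cycSuc zero    i = refl
    unrotate-cycSuc (suc a) i = ≡.trans (cong cycPred (unrotate-cycSuc a i))
      (≡.trans (cycPred-cycSuc _) (≡.sym (cycSuc-cycPred _)))

    unrotate-rotate : ∀ a i → unrotate a (rotate a i) ≡ i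
    unrotate-rotate zero    i = refl
    unrotate-rotate (suc a) i = ≡.trans (cong cycPred (unrotate-cycSuc a (rotate a i)))
      (≡.trans (cycPred-cycSuc _) (unrotate-rotate a i))

    r10^-false : ∀ a i → r10^ a (i , false) ≡ (rotate a i , false)
    r10^-false zero    i = refl
    r10^-false (suc a) i = cong (λ y → r1 (r0 y)) (r10^-false a i)

    r10^-true : ∀ a i → r10^ a (i , true) ≡ (unrotate a i , true)
    r10^-true zero    i = refl
    r10^-true (suc a) i = cong (λ y → r1 (r0 y)) (r10^-true a i)

    -- On `true` flags r1 r0 turns the polygon backwards, but `K` is half of `N`, so both directions
    -- reach the opposite side.
    r2-side : ∀ h j b → r2 (side h j , b) ≡ (side (not h) j , not b)
    r2-side h j false = cong r0 (≡.trans (r10^-false K _) (cong (_, false) (rotate-K h j)))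
    r2-side h j true  = cong r0 (≡.trans (r10^-true K _) (cong (_, true) (begin
      unrotate K (side h j)                      ≡⟨ cong (λ g → unrotate K (side g j)) (not-involutive h) ⟨
      unrotate K (side (not (not h)) j)          ≡⟨ cong (unrotate K) (rotate-K (not h) j) ⟨
      unrotate K (rotate K (side (not h) j))     ≡⟨ unrotate-rotate K _ ⟩
      side (not h) j                             ∎)))
      where open ≡.≡-Reasoning

    ρX-invol : ∀ i x → ρX i (ρX i x) ≡ x
    ρX-invol 0F (i , b)     = cong (i ,_) (not-involutive b)
    ρX-invol 1F (i , false) = cong (_, false) (cycSuc-cycPred i)
    ρX-invol 1F (i , true)  = cong (_, true) (cycPred-cycSuc i)
    ρX-invol 2F (i , b) with side-view i
    ... | mk h j = ≡.trans (cong r2 (r2-side h j b)) (≡.trans (r2-side (not h) j (not b))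
            (cong₂ (λ g c → side g j , c) (not-involutive h) (not-involutive b)))

    open Graph X
    open Involutive X ρX-invol

    r10-word : ℕ → List (Fin 3)
    r10-word zero    = []
    r10-word (suc a) = r10-word a ++ 0F ∷ 1F ∷ []

    act-r10-word : ∀ a x → act X (r10-word a) x ≡ r10^ a x
    act-r10-word zero    x = refl
    act-r10-word (suc a) x = ≡.trans (act-++ (r10-word a) _ x) (cong (λ y → r1 (r0 y)) (act-r10-word a x))

    r10-word-colours : ∀ a → All (_≢ 2F) (r10-word a)
    r10-word-colours zero    = []
    r10-word-colours (suc a) = Allₚ.++⁺ (r10-word-colours a) ((λ ()) ∷ (λ ()) ∷ [])

    -- Corner i of the 4k-gon lies between e_{i-1} and e_i.
    corner : XFlag → Side
    corner (i , false) = i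
    corner (i , true)  = cycSuc i

    corner-r1 : ∀ x → corner (r1 x) ≡ corner x
    corner-r1 (i , false) = cycSuc-cycPred i
    corner-r1 (i , true)  = refl

    corner-injective : ∀ x y → corner x ≡ corner y → y ≡ x ⊎ y ≡ r1 x
    corner-injective (i , false) (j , false) p    = inj₁ (cong (_, false) (≡.sym p))
    corner-injective (i , true)  (j , true)  p    = inj₁ (cong (_, true)
      (≡.trans (≡.sym (cycPred-cycSuc j)) (≡.trans (cong cycPred (≡.sym p)) (cycPred-cycSuc i))))
    corner-injective (i , false) (j , true)  p    = inj₂ (cong (_, true)
      (≡.sym (≡.trans (cong cycPred p) (cycPred-cycSuc j))))
    corner-injective (i , true)  (j , false) p    = inj₂ (cong (_, false) (≡.sym p))

    module Origin (o : Fin K) (o≡0 : toℕ o ≡ 0) where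

      origin : Bool → XFlag
      origin h = side h o , false

      r10^-origin : ∀ h h′ j → r10^ (toℕ (side h′ j)) (origin h) ≡ (side (h xor h′) j , false)
      r10^-origin h h′ j = ≡.trans (r10^-false (toℕ (side h′ j)) (side h o))
        (cong (_, false) (rotate-from-origin h h′ j o≡0))

      facet-path : ∀ x → PathIn X (_≢ 2F) (origin false) x
      facet-path (i , false) with side-view i
      ... | mk h j = r10-word a , r10-word-colours a , ≡.trans (act-r10-word a _) (r10^-origin false h j)
        where a = toℕ (side h j)
      facet-path (i , true) = path-trans (facet-path (i , false)) (path-step 0F _ λ ())

      private
        alternate : ℕ → Bool → Bool
        alternate zero    h = h
        alternate (suc s) h = not (alternate s h)

        alternate-+ : ∀ s t h → alternate (s + t) h ≡ alternate s (alternate t h)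
        alternate-+ zero    t h = refl
        alternate-+ (suc s) t h = cong not (alternate-+ s t h)

        alternate-not : ∀ s h → alternate s (not h) ≡ not (alternate s h)
        alternate-not zero    h = refl
        alternate-not (suc s) h = cong not (alternate-not s h)

        alternate-double : ∀ s h → alternate s (alternate s h) ≡ h
        alternate-double zero    h = refl
        alternate-double (suc s) h = ≡.trans (cong not (alternate-not s (alternate s h)))
          (≡.trans (not-involutive _) (alternate-double s h))

        alternate-K : ∀ h → alternate K h ≡ h
        alternate-K h = ≡.trans (cong (λ t → alternate (k + t) h) (ℕₚ.+-identityʳ k))
          (≡.trans (alternate-+ k k h) (alternate-double k h))

        cross-path : ∀ h j → PathIn X (_≢ 0F) (side h j , false) (cycSuc (side (not h) j) , false)
        cross-path h j = 2F ∷ 1F ∷ [] , (λ ()) ∷ (λ ()) ∷ [] , cong r1 (r2-side h j false)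

        -- Around the vertex, one crossing followed by colour 1 raises the index by one and changes
        -- the half.
        corner-path : ∀ s h j → toℕ j ≡ s → PathIn X (_≢ 0F) (origin h) (side (alternate s h) j , false)
        corner-path zero    h j p = path-refl (cong (λ i → side h i , false)
          (Finₚ.toℕ-injective (≡.trans o≡0 (≡.sym p))))
        corner-path (suc s) h j p = path-trans (corner-path s h j⁻ toℕ-j⁻)
          (path-trans (cross-path (alternate s h) j⁻)
            (path-refl (cong (_, false) (cycSuc-inner (alternate (suc s) h)
              (≡.trans p (cong suc (≡.sym toℕ-j⁻)))))))
          where
            s<K = ℕₚ.<⇒≤ (subst (_< K) p (Finₚ.toℕ<n j))
            j⁻ = fromℕ< s<K
            toℕ-j⁻ = Finₚ.toℕ-fromℕ< s<K

        -- `K` crossings change the half `K` times, an even number, and passing from index `K` - 1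
        -- to index 0 changes it once more. Evenness of `K` is what leaves `X` with a single vertex.
        opposite-origin : PathIn X (_≢ 0F) (origin false) (origin true)
        opposite-origin = path-trans (corner-path (K ∸ 1) false l toℕ-l)
          (path-trans (cross-path a l) (path-refl (cong (_, false)
            (≡.trans (cycSuc-last (not a) (≡.trans (cong suc toℕ-l) 1+K∸1) o≡0)
                     (cong (λ h → side h o) not-not-a)))))
          where
            1+K∸1 : 1 + (K ∸ 1) ≡ K
            1+K∸1 = ℕₚ.m+[n∸m]≡n (ℕₚ.≤-trans (s≤s z≤n) (Finₚ.toℕ<n o))
            K∸1<K = ℕₚ.≤-reflexive 1+K∸1
            l = fromℕ< K∸1<K
            toℕ-l = Finₚ.toℕ-fromℕ< K∸1<K
            a = alternate (K ∸ 1) false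
            not-a : not a ≡ false
            not-a = ≡.trans (cong (λ t → alternate t false) 1+K∸1) (alternate-K false)
            not-not-a : not (not a) ≡ true
            not-not-a = cong not not-a

      vertex-path : ∀ x → PathIn X (_≢ 0F) (origin false) x
      vertex-path (i , true) =
        path-trans (vertex-path (cycSuc i , false))
          (path-trans (path-step 1F _ λ ()) (path-refl (cong (_, true) (cycPred-cycSuc i))))
      vertex-path (i , false) with side-view i
      -- The starting half is the one that `toℕ j` changes turn into `h`.
      ... | mk h j = path-trans (reach (alternate (toℕ j) h)) (path-trans (corner-path (toℕ j) _ j refl)
              (path-refl (cong (λ g → side g j , false) (alternate-double (toℕ j) h))))
        where
          reach : ∀ h → PathIn X (_≢ 0F) (origin false) (origin h)
          reach false = path-refl refl
          reach true  = opposite-origin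

-- The derived graph: voltages and simplicity.

module Construction (k′ : ℕ) (P : Raw (suc (2 * suc (suc k′))))
    (polytope : IsPolytope P) (chiral : IsChiral {G = P}) (simple : SimplePetriePolygons P)
    (Φ : Flag P) (τ : Fin (2 * suc (suc k′)) → Aut P)
    (τΦ : ∀ j → _≈_ P (Φ · τ j) (r P (Fin.suc j) (r P Fin.zero Φ))) where

  open Family2 (suc (suc k′))
  open Polygon (suc (suc k′))
  open Origin Fin.zero refl
  open IsPolytope polytope
  open IsManiplex maniplex
  open IsPremaniplex premaniplex
  open Graph P
  open Involutive P r-invol
  open Connected P premaniplex
  open PetrieWalk P polytope
  open Irreducible P polytope chiral using (r₀-comm; no-comm₀₁; no-comm₁₂)
  open Chirality P premaniplex chiral

  private
    r₀ = r P 0F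

    Y : Raw 3
    Y = Xξ τ

    module X = Graph X
    module XI = Involutive X ρX-invol
    module Y = Graph Y

  volt : Bool → Fin K → Aut P
  volt false j = τ j
  volt true  j = invAut (τ j)

  volt-inverse : ∀ h j z → ((z · volt (not h) j) · volt h j) ≋ z
  volt-inverse false j z = to-from (τ j) z
  volt-inverse true  j z = from-to (τ j) z

  ξ-side : ∀ h j b → ξ τ 2F (side h j , b) ≡ volt h j
  ξ-side false j b rewrite Finₚ.splitAt-↑ˡ K j K = refl
  ξ-side true  j b rewrite Finₚ.splitAt-↑ʳ K K j = refl

  ξ-at : ∀ h j b {y} → y ≡ (side h j , b) → ∀ z → (z · ξ τ 2F y) ≋ (z · volt h j)
  ξ-at h j b refl z = ≋-reflexive (cong (z ·_) (ξ-side h j b))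

  at : Bool → Flag P → Flag P
  at false z = z
  at true  z = r₀ z

  at-cong : ∀ h {x y} → x ≋ y → at h x ≋ at h y
  at-cong false p = p
  at-cong true  p = r-cong P 0F p

  at-aut : ∀ h (γ : Aut P) z → (at h z · γ) ≋ at h (z · γ)
  at-aut false γ z = ≋-refl
  at-aut true  γ z = to-r γ 0F z

  r₀-at : ∀ h z → r₀ (at h z) ≋ at (not h) z
  r₀-at false z = ≋-refl
  r₀-at true  z = r-invol 0F z

  volt-flip : ∀ h j x → (x · volt h j) ≋ r P (Fin.suc j) (r₀ x) →
              (x · volt (not h) j) ≋ r₀ (r P (Fin.suc j) x)
  volt-flip h j x p = aut-injective (volt h j) (begin
    (x · volt (not h) j) · volt h j       ≈⟨ volt-inverse h j x ⟩
    x                                     ≈⟨ r-invol 0F x ⟨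
    r₀ (r₀ x)                             ≈⟨ r-cong P 0F (r-invol (Fin.suc j) _) ⟨
    act P w (r P (Fin.suc j) (r₀ x))      ≈⟨ act-cong w p ⟨
    act P w (x · volt h j)                ≈⟨ act-aut (volt h j) w x ⟨
    act P w x · volt h j                  ∎)
    where
      open ≋-Reasoning
      w = Fin.suc j ∷ 0F ∷ []

  -- Passing from Φ to r₀Φ compensates for inverting the voltage, so one formula serves both halves
  -- of the polygon.
  at-volt : ∀ h j → (at h Φ · volt h j) ≋ r P (Fin.suc j) (r₀ (at h Φ))
  at-volt false j = τΦ j
  at-volt true  j = begin
    r₀ Φ · volt true j                 ≈⟨ at-aut true (volt true j) Φ ⟩
    r₀ (Φ · volt true j)               ≈⟨ r-cong P 0F (volt-flip false j Φ (τΦ j)) ⟩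
    r₀ (r₀ (r P (Fin.suc j) Φ))        ≈⟨ r-invol 0F _ ⟩
    r P (Fin.suc j) Φ                  ≈⟨ r-cong P (Fin.suc j) (r-invol 0F Φ) ⟨
    r P (Fin.suc j) (r₀ (r₀ Φ))        ∎
    where open ≋-Reasoning

  at-volt⁻ : ∀ h j → (at h Φ · volt (not h) j) ≋ r₀ (r P (Fin.suc j) (at h Φ))
  at-volt⁻ h j = volt-flip h j (at h Φ) (at-volt h j)

  r₂-side : ∀ h j b γ → r Y 2F ((side h j , b) , γ) Y.≋ ((side (not h) j , not b) , volt h j ∘A γ)
  r₂-side h j b γ = r2-side h j b , λ z → to-cong γ (ξ-at h j b refl z)

  Y-invol : ∀ i u → r Y i (r Y i u) Y.≋ u
  Y-invol 0F (x , γ) = ρX-invol 0F x , λ _ → ≋-refl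
  Y-invol 1F (x , γ) = ρX-invol 1F x , λ _ → ≋-refl
  Y-invol 2F ((i , b) , γ) with side-view i
  ... | mk h j = begin
    r Y 2F (r Y 2F ((side h j , b) , γ))
      ≈⟨ r-cong Y 2F {_ , ξ τ 2F (side h j , b) ∘A γ} {_ , volt h j ∘A γ} (r₂-side h j b γ) ⟩
    r Y 2F ((side (not h) j , not b) , volt h j ∘A γ)
      ≈⟨ r₂-side (not h) j (not b) (volt h j ∘A γ) ⟩
    ((side (not (not h)) j , not (not b)) , volt (not h) j ∘A (volt h j ∘A γ))
      ≈⟨ cong₂ (λ g c → side g j , c) (not-involutive h) (not-involutive b) ,
         (λ z → to-cong γ (volt-inverse h j z)) ⟩
    ((side h j , b) , γ) ∎
    where open Y.≋-Reasoning

  private module YI = Involutive Y Y-invol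

  Y-comm : ∀ u → r Y 0F (r Y 2F u) Y.≋ r Y 2F (r Y 0F u)
  Y-comm ((i , b) , γ) with side-view i
  ... | mk h j = begin
    r Y 0F (r Y 2F ((side h j , b) , γ))
      ≈⟨ r-cong Y 0F {_ , ξ τ 2F (side h j , b) ∘A γ} {_ , volt h j ∘A γ} (r₂-side h j b γ) ⟩
    r Y 0F ((side (not h) j , not b) , volt h j ∘A γ)
      ≈⟨ refl , (λ _ → ≋-refl) ⟩
    ((side (not h) j , not (not b)) , volt h j ∘A γ)
      ≈⟨ r₂-side h j (not b) γ ⟨
    r Y 2F ((side h j , not b) , γ)
      ≈⟨ r-cong Y 2F {_ , idAut ∘A γ} {_ , γ} (refl , λ _ → ≋-refl) ⟨
    r Y 2F (r Y 0F ((side h j , b) , γ)) ∎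
    where open Y.≋-Reasoning

  act-trivial : ∀ {w} → All (_≢ 2F) w → ∀ x γ → act Y w (x , γ) Y.≋ (act X w x , γ)
  act-trivial []                  x γ = refl , λ _ → ≋-refl
  act-trivial {0F ∷ w} (_ ∷ qs)   x γ = act-trivial qs (r0 x) (idAut ∘A γ)
  act-trivial {1F ∷ w} (_ ∷ qs)   x γ = act-trivial qs (r1 x) (idAut ∘A γ)
  act-trivial {2F ∷ w} (2≢2 ∷ _)  x γ = ⊥-elim (2≢2 refl)

  act-fst : ∀ w u → proj₁ (act Y w u) ≡ act X w (proj₁ u)
  act-fst []       u = refl
  act-fst (i ∷ w) u = act-fst w (r Y i u)

  cycSuc-≢-self : ∀ h j → cycSuc (side h j) ≢ side h j
  cycSuc-≢-self h j p with next-side h j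
  ... | inj₁ (j′ , q , e) = ℕₚ.1+n≢n (≡.trans (≡.sym q) (cong toℕ (side-injective h (≡.trans (≡.sym e) p))))
  ... | inj₂ (_ , e)      = side-≢ h (≡.trans (≡.sym p) (e 0F refl))

  cycSuc-≢-opposite : ∀ h j → cycSuc (side h j) ≢ side (not h) j
  cycSuc-≢-opposite h j p with next-side h j
  ... | inj₁ (j′ , q , e) = side-≢ h (≡.trans (≡.sym e) p)
  ... | inj₂ (q , e) with side-injective (not h) (≡.trans (≡.sym (e 0F refl)) p) | q
  ... | refl | ()

  -- The derived graph projects to `X`, so simplicity of `X` suffices whatever the voltages are.
  X-noParallel : ∀ i j x → i ≢ j → ρX i x ≢ ρX j x
  X-noParallel 0F 0F x i≢j = ⊥-elim (i≢j refl)
  X-noParallel 1F 1F x i≢j = ⊥-elim (i≢j refl)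
  X-noParallel 2F 2F x i≢j = ⊥-elim (i≢j refl)
  X-noParallel 1F 0F x i≢j p = X-noParallel 0F 1F x (λ ()) (≡.sym p)
  X-noParallel 2F 0F x i≢j p = X-noParallel 0F 2F x (λ ()) (≡.sym p)
  X-noParallel 2F 1F x i≢j p = X-noParallel 1F 2F x (λ ()) (≡.sym p)
  X-noParallel 0F 1F (i , b) _ p with side-view i
  X-noParallel 0F 1F (_ , false) _ p | mk h j = cycSuc-≢-self h j
    (≡.trans (cong (λ y → cycSuc (proj₁ y)) p) (cycSuc-cycPred _))
  X-noParallel 0F 1F (_ , true)  _ p | mk h j = cycSuc-≢-self h j (≡.sym (cong proj₁ p))
  X-noParallel 0F 2F (i , b) _ p with side-view i
  ... | mk h j = side-≢ h (cong proj₁ (≡.trans p (r2-side h j b)))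
  X-noParallel 1F 2F (i , b) _ p with side-view i
  X-noParallel 1F 2F (_ , false) _ p | mk h j = cycSuc-≢-opposite (not h) j
    (≡.trans (cong cycSuc (≡.sym (cong proj₁ (≡.trans p (r2-side h j false)))))
      (≡.trans (cycSuc-cycPred _) (cong (λ g → side g j) (≡.sym (not-involutive h)))))
  X-noParallel 1F 2F (_ , true) _ p | mk h j = cycSuc-≢-opposite h j
    (cong proj₁ (≡.trans p (r2-side h j true)))

  X-noSemiEdge : ∀ i x → ρX i x ≢ x
  X-noSemiEdge 0F (i , b)     p = not-¬ refl (≡.sym (cong proj₂ p))
  X-noSemiEdge 1F (i , false) ()
  X-noSemiEdge 1F (i , true)  ()
  X-noSemiEdge 2F (i , b) p with side-view i
  ... | mk h j = side-≢ h (≡.sym (cong proj₁ (≡.trans (≡.sym (r2-side h j b)) p)))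

  -- Closed words, relations between voltages, and the orbits of flags.

  prod : XFlag → List ℕ → Aut P
  prod x []       = idAut
  -- A later crossing multiplies from the left, so its factor acts first.
  prod x (a ∷ as) = prod x as ∘A ξ τ 2F (r10^ a x)

  prod-++ : ∀ x as bs z → (z · prod x (as ++ bs)) ≋ ((z · prod x bs) · prod x as)
  prod-++ x []       bs z = ≋-refl
  prod-++ x (a ∷ as) bs z = to-cong (ξ τ 2F (r10^ a x)) (prod-++ x as bs z)

  -- The word walks a sides along the facet, crosses the side it has reached and
  -- returns to the copy of its starting flag in the adjacent facet.
  hop : ℕ → List (Fin 3)
  hop a = r10-word a ++ 2F ∷ reverse (r10-word (K + a) ++ 0F ∷ [])

  r10^-+ : ∀ a b x → r10^ (a + b) x ≡ r10^ a (r10^ b x)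
  r10^-+ zero    b x = refl
  r10^-+ (suc a) b x = cong (λ y → r1 (r0 y)) (r10^-+ a b x)

  -- Since r2 is r0 (r1 r0)^K, the flag reached by the crossing is also reached from `x`, inside the
  -- new facet, by `K + a` turns and colour 0. Retracing that path ends over `x`.
  act-hop : ∀ a x γ → act Y (hop a) (x , γ) Y.≋ (x , ξ τ 2F (r10^ a x) ∘A γ)
  act-hop a x γ = begin
    act Y (hop a) (x , γ)
      ≡⟨ Y.act-++ (r10-word a) _ (x , γ) ⟩
    act Y (2F ∷ reverse v) (act Y (r10-word a) (x , γ))
      ≈⟨ Y.act-cong (2F ∷ reverse v) {act Y (r10-word a) (x , γ)} {r10^ a x , γ} there ⟩
    act Y (reverse v) (r Y 2F (r10^ a x , γ))
      ≈⟨ Y.act-cong (reverse v) {act Y v (x , δ)} {r Y 2F (r10^ a x , γ)} back ⟨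
    act Y (reverse v) (act Y v (x , δ))
      ≈⟨ YI.act-reverse v (x , δ) ⟩
    (x , δ) ∎
    where
      open Y.≋-Reasoning
      v = r10-word (K + a) ++ 0F ∷ []
      δ = ξ τ 2F (r10^ a x) ∘A γ

      there : act Y (r10-word a) (x , γ) Y.≋ (r10^ a x , γ)
      there with act-trivial (r10-word-colours a) x γ
      ... | p , q = ≡.trans p (act-r10-word a x) , q

      back : act Y v (x , δ) Y.≋ r Y 2F (r10^ a x , γ)
      back with act-trivial (Allₚ.++⁺ (r10-word-colours (K + a)) ((λ ()) ∷ [])) x δ
      ... | p , q = ≡.trans p (≡.trans (X.act-++ (r10-word (K + a)) _ x)
            (cong r0 (≡.trans (act-r10-word (K + a) x) (r10^-+ K a x)))) , q

  hops : List ℕ → List (Fin 3)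
  hops = concatMap hop

  act-hops : ∀ as x γ → act Y (hops as) (x , γ) Y.≋ (x , prod x as ∘A γ)
  act-hops []       x γ = refl , λ _ → ≋-refl
  act-hops (a ∷ as) x γ = begin
    act Y (hop a ++ hops as) (x , γ)          ≡⟨ Y.act-++ (hop a) (hops as) (x , γ) ⟩
    act Y (hops as) (act Y (hop a) (x , γ))   ≈⟨ Y.act-cong (hops as) {act Y (hop a) (x , γ)} {x , δ} (act-hop a x γ) ⟩
    act Y (hops as) (x , δ)                   ≈⟨ act-hops as x δ ⟩
    (x , prod x as ∘A δ)                      ≈⟨ refl , (λ _ → ≋-refl) ⟩
    (x , prod x (a ∷ as) ∘A γ)                ∎
    where
      open Y.≋-Reasoning
      δ = ξ τ 2F (r10^ a x) ∘A γ

  -- The word hops as fixes a flag over x exactly when its voltage prod x as is trivial,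
  -- and an automorphism preserves which words fix a flag.
  transfer-relation : ∀ u v → SameOrbit {G = Y} u v → ∀ as {z z′} →
    (z · prod (proj₁ u) as) ≋ z → (z′ · prod (proj₁ v) as) ≋ z′
  transfer-relation (x , γ) (y , δ) (α , p) as {z} {z′} c = aut-injective δ (proj₂ closed z′)
    where
      open Y.≋-Reasoning
      closed : (y , prod y as ∘A δ) Y.≋ (y , δ)
      closed = begin
        (y , prod y as ∘A δ)                ≈⟨ act-hops as y δ ⟨
        act Y (hops as) (y , δ)             ≈⟨ Y.act-cong (hops as) {to α (x , γ)} {y , δ} p ⟨
        act Y (hops as) (to α (x , γ))      ≈⟨ Y.act-aut α (hops as) (x , γ) ⟨
        to α (act Y (hops as) (x , γ))
          ≈⟨ to-cong α {act Y (hops as) (x , γ)} {x , prod x as ∘A γ} (act-hops as x γ) ⟩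
        to α (x , prod x as ∘A γ)           ≈⟨ to-cong α {x , prod x as ∘A γ} {x , γ}
          (refl , λ w → to-cong γ (aut-determined (prod x as) idAut z c w)) ⟩
        to α (x , γ)                        ≈⟨ p ⟩
        (y , δ)                             ∎

  volt-origin : ∀ h h′ j z → (z · ξ τ 2F (r10^ (toℕ (side h′ j)) (origin h))) ≋ (z · volt (h xor h′) j)
  volt-origin h h′ j = ξ-at (h xor h′) j false (r10^-origin h h′ j)

  private
    plus minus : Fin (suc K) → List ℕ
    plus  Fin.zero    = []
    plus  (Fin.suc j) = toℕ (side false j) ∷ []
    minus Fin.zero    = []
    minus (Fin.suc j) = toℕ (side true j) ∷ []

    at-plus : ∀ h i → (at h Φ · prod (origin h) (plus i)) ≋ r P i (r₀ (at h Φ))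
    at-plus h     Fin.zero    = ≋-sym (r-invol 0F _)
    at-plus false (Fin.suc j) = ≋-trans (volt-origin false false j Φ) (at-volt false j)
    at-plus true  (Fin.suc j) = ≋-trans (volt-origin true false j (r₀ Φ)) (at-volt true j)

    at-minus : ∀ h i → (at h Φ · prod (origin h) (minus i)) ≋ r₀ (r P i (at h Φ))
    at-minus h     Fin.zero    = ≋-sym (r-invol 0F _)
    at-minus false (Fin.suc j) = ≋-trans (volt-origin false true j Φ) (at-volt⁻ false j)
    at-minus true  (Fin.suc j) = ≋-trans (volt-origin true true j (r₀ Φ)) (at-volt⁻ true j)

  -- Rests on rⱼrᵢ = (rⱼr₀)(r₀rᵢ), whose factors are the effects of τⱼ and τᵢ⁻¹ on Φ. Colour 0 needs
  -- no crossing. The default drops an unpaired letter; only even words are evaluated.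
  code : List (Fin (suc K)) → List ℕ
  code (i ∷ j ∷ w) = minus i ++ (plus j ++ code w)
  code _           = []

  at-code : ∀ h {w} → Even w → (at h Φ · prod (origin h) (code w)) ≋ act P w (at h Φ)
  at-code h [] = ≋-refl
  at-code h (∷∷_ {i} {j} {w} e) = begin
    x · π (minus i ++ (plus j ++ code w))           ≈⟨ prod-++ (origin h) (minus i) _ x ⟩
    (x · π (plus j ++ code w)) · μ                  ≈⟨ to-cong μ (prod-++ (origin h) (plus j) _ x) ⟩
    ((x · π (code w)) · π (plus j)) · μ             ≈⟨ to-cong μ (to-cong (π (plus j)) (at-code h e)) ⟩
    (act P w x · π (plus j)) · μ                    ≈⟨ to-cong μ (act-aut (π (plus j)) w x) ⟩
    act P w (x · π (plus j)) · μ                    ≈⟨ to-cong μ (act-cong w (at-plus h j)) ⟩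
    act P (0F ∷ j ∷ w) x · μ                        ≈⟨ act-aut μ (0F ∷ j ∷ w) x ⟩
    act P (0F ∷ j ∷ w) (x · μ)                      ≈⟨ act-cong (0F ∷ j ∷ w) (at-minus h i) ⟩
    act P (0F ∷ j ∷ w) (r₀ (r P i x))               ≈⟨ act-cong (j ∷ w) (r-invol 0F _) ⟩
    act P (j ∷ w) (r P i x)                         ∎
    where
      open ≋-Reasoning
      x = at h Φ
      π = prod (origin h)
      μ = π (minus i)

  -- Read from the opposite origin every voltage is inverted, and the same code acts on r₀Φ as the
  -- word `w`. Each word fixing Φ would thus fix r₀Φ.
  no-inversion : ∀ γ δ → ¬ SameOrbit {G = Y} (origin false , γ) (origin true , δ)
  no-inversion γ δ s = not-reflexible 0F Φ λ w p →
    let e = even-of-orbit w (orbit-refl ≋-refl) p in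
    ≋-trans (≋-sym (at-code true e))
      (transfer-relation (origin false , γ) (origin true , δ) s (code w)
        (≋-trans (at-code false e) p))

  private
    twist : ∀ h i j → ((at h Φ · volt h i) · volt (not h) j) ≋ r P (Fin.suc i) (r P (Fin.suc j) (at h Φ))
    twist h i j = begin
      (x · volt h i) · volt (not h) j              ≈⟨ to-cong (volt (not h) j) (at-volt h i) ⟩
      act P (0F ∷ Fin.suc i ∷ []) x · volt (not h) j  ≈⟨ act-aut (volt (not h) j) (0F ∷ Fin.suc i ∷ []) x ⟩
      act P (0F ∷ Fin.suc i ∷ []) (x · volt (not h) j)  ≈⟨ act-cong (0F ∷ Fin.suc i ∷ []) (at-volt⁻ h j) ⟩
      r P (Fin.suc i) (r₀ (r₀ (r P (Fin.suc j) x)))    ≈⟨ r-cong P (Fin.suc i) (r-invol 0F _) ⟩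
      r P (Fin.suc i) (r P (Fin.suc j) x)              ∎
      where
        open ≋-Reasoning
        x = at h Φ

  closed-twice : (α : Aut P) (w : List (Fin (suc K))) → ∀ {x} → (x · α) ≋ act P w x →
                 ((x · α) · α) ≋ act P w (act P w x)
  closed-twice α w p = ≋-trans (to-cong α p) (≋-trans (act-aut α w _) (act-cong w p))

  -- Index `Fin.suc j` belongs to colour `2+ j`, which commutes with `r₀`.
  volt-involutive : ∀ h j → ((at h Φ · volt h (Fin.suc j)) · volt h (Fin.suc j)) ≋ at h Φ
  volt-involutive h j = begin
    (x · α) · α                           ≈⟨ closed-twice α (0F ∷ 2+ j ∷ []) (at-volt h (Fin.suc j)) ⟩
    act P (0F ∷ 2+ j ∷ 0F ∷ 2+ j ∷ []) x  ≈⟨ r-cong P (2+ j) (r₀-comm (2+ j) (s≤s (s≤s z≤n)) _) ⟩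
    r P (2+ j) (r P (2+ j) (r₀ (r₀ x)))   ≈⟨ r-invol (2+ j) _ ⟩
    r₀ (r₀ x)                             ≈⟨ r-invol 0F x ⟩
    x                                     ∎
    where
      open ≋-Reasoning
      x = at h Φ
      α = volt h (Fin.suc j)

  volt-not-involutive : ¬ ((Φ · volt false 0F) · volt false 0F) ≋ Φ
  volt-not-involutive p = no-comm₀₁ Φ (≋-sym (comm-of-closed 1F 0F Φ
    (≋-trans (≋-sym (closed-twice (τ 0F) (0F ∷ 1F ∷ []) (τΦ 0F))) p)))

  last : Fin K
  last = Fin.fromℕ _

  suc-last : suc (toℕ last) ≡ K
  suc-last = cong suc (Finₚ.toℕ-fromℕ _)

  2≤last : 2 ≤ toℕ last
  2≤last = ℕ.s≤s⁻¹ (subst (3 ≤_) (≡.sym suc-last)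
    (s≤s (s≤s (ℕₚ.≤-trans (s≤s z≤n) (ℕₚ.m≤n+m (suc (suc (k′ + 0))) k′)))))

  cycPred-origin : ∀ h → cycPred (side h 0F) ≡ side (not h) last
  cycPred-origin h = ≡.trans
    (cong cycPred (≡.trans (cong (λ g → side g 0F) (≡.sym (not-involutive h)))
                           (≡.sym (cycSuc-last (not h) suc-last refl))))
    (cycPred-cycSuc _)

  -- From a `true` flag the turn goes backwards, from index 0 to `last`, so the two crossings
  -- combine colours 1 and 2k. These commute since 2k - 1 ≥ 2. From the origin the same word
  -- combines colours 1 and 2, which would then commute too.
  no-reflection : ∀ h γ δ → ¬ SameOrbit {G = Y} (origin false , γ) ((side h 0F , true) , δ)
  no-reflection h γ δ s = no-comm₁₂ Φ (comm-of-closed 1F 2F Φ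
    (≋-trans (≋-sym (closed-twice (prod (origin false) (1 ∷ 0 ∷ [])) (2F ∷ 1F ∷ []) at-origin))
      (transfer-relation ((side h 0F , true) , δ) (origin false , γ) (Y.orbit-sym s) (1 ∷ 0 ∷ 1 ∷ 0 ∷ [])
        {at h Φ} {Φ} closed)))
    where
      open ≋-Reasoning

      at-origin : (Φ · prod (origin false) (1 ∷ 0 ∷ [])) ≋ act P (2F ∷ 1F ∷ []) Φ
      at-origin = begin
        (Φ · ξ τ 2F (origin false)) · ξ τ 2F (r10^ 1 (origin false))
          ≈⟨ ξ-at false 1F false (cong (_, false) (cycSuc-inner false refl)) _ ⟩
        (Φ · ξ τ 2F (origin false)) · τ 1F
          ≈⟨ to-cong (τ 1F) (ξ-at false 0F false refl Φ) ⟩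
        (Φ · τ 0F) · τ 1F
          ≈⟨ to-cong (τ 1F) (τΦ 0F) ⟩
        act P (0F ∷ 1F ∷ []) Φ · τ 1F
          ≈⟨ act-aut (τ 1F) (0F ∷ 1F ∷ []) Φ ⟩
        act P (0F ∷ 1F ∷ []) (Φ · τ 1F)
          ≈⟨ act-cong (0F ∷ 1F ∷ []) (τΦ 1F) ⟩
        r P 1F (r₀ (r P 2F (r₀ Φ)))
          ≈⟨ r-cong P 1F (r-cong P 0F (r₀-comm 2F (s≤s (s≤s z≤n)) Φ)) ⟨
        r P 1F (r₀ (r₀ (r P 2F Φ)))
          ≈⟨ r-cong P 1F (r-invol 0F _) ⟩
        r P 1F (r P 2F Φ) ∎

      x = at h Φ
      l = Fin.suc last
      α = prod (side h 0F , true) (1 ∷ 0 ∷ [])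

      at-reflected : (x · α) ≋ act P (l ∷ 1F ∷ []) x
      at-reflected = begin
        (x · ξ τ 2F (side h 0F , true)) · ξ τ 2F (r10^ 1 (side h 0F , true))
          ≈⟨ ξ-at (not h) last true (cong (_, true) (cycPred-origin h)) _ ⟩
        (x · ξ τ 2F (side h 0F , true)) · volt (not h) last
          ≈⟨ to-cong (volt (not h) last) (ξ-at h 0F true refl x) ⟩
        (x · volt h 0F) · volt (not h) last
          ≈⟨ twist h 0F last ⟩
        r P 1F (r P l x) ∎

      closed : (x · prod (side h 0F , true) (1 ∷ 0 ∷ 1 ∷ 0 ∷ [])) ≋ x
      closed = ≋-trans (closed-twice α (l ∷ 1F ∷ []) at-reflected)
                       (r-comm 1F l 2≤last x)

  -- Crossing the same side twice separates the indices: the voltage squares to the identity for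
  -- every index above 0, but not for index 0. Of the four flags with index 0, two are reversed and
  -- one is the opposite origin.
  origin-orbit : ∀ x γ δ → SameOrbit {G = Y} (origin false , γ) (x , δ) → x ≡ origin false
  origin-orbit (i , b) γ δ s with side-view i
  ... | mk h (Fin.suc j) = ⊥-elim (volt-not-involutive
          (≋-trans (≋-sym (square false 0F false Φ))
            (transfer-relation ((side h (Fin.suc j) , b) , δ) (origin false , γ) (Y.orbit-sym s) (0 ∷ 0 ∷ [])
            (≋-trans (square h (Fin.suc j) b (at h Φ)) (volt-involutive h j)))))
    where
      square : ∀ h j b z → (z · prod (side h j , b) (0 ∷ 0 ∷ [])) ≋ ((z · volt h j) · volt h j)
      square h j b z = ≋-trans (ξ-at h j b refl _) (to-cong (volt h j) (ξ-at h j b refl z))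
  origin-orbit (_ , true)  γ δ s | mk h     Fin.zero = ⊥-elim (no-reflection h γ δ s)
  origin-orbit (_ , false) γ δ s | mk false Fin.zero = refl
  origin-orbit (_ , false) γ δ s | mk true  Fin.zero = ⊥-elim (no-inversion γ δ s)

  -- A word carrying `u` over the origin is applied to both flags and undone in `X` afterwards.
  orbit⇒≡ : ∀ u v → SameOrbit {G = Y} u v → proj₁ u ≡ proj₁ v
  orbit⇒≡ u v s with XI.path-sym {x = origin false} (facet-path (proj₁ u))
  ... | w , _ , p = XI.act-injective w (≡.trans p (≡.sym (≡.trans (≡.sym (act-fst w v))
        (origin-orbit (proj₁ (act Y w v)) (proj₂ (act Y w u)) (proj₂ (act Y w v))
          (subst (λ x → SameOrbit {G = Y} (x , proj₂ (act Y w u)) (act Y w v))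
            (≡.trans (act-fst w u) p) (Y.orbit-act w {u} {v} s))))))

  -- Translations, transitivity and connectedness.

  translate : Aut P → Aut Y
  translate δ = record
    { to        = λ (x , γ) → x , γ ∘A δ
    ; from      = λ (x , γ) → x , γ ∘A invAut δ
    ; to-cong   = λ (p , q) → p , λ z → to-cong δ (q z)
    ; from-cong = λ (p , q) → p , λ z → from-cong δ (q z)
    -- Voltages multiply from the left and so commute with translation on the right.
    ; to-r      = λ _ _ → refl , λ _ → ≋-refl
    ; to-from   = λ (x , γ) → refl , λ z → to-from δ (to γ z)
    ; from-to   = λ (x , γ) → refl , λ z → from-to δ (to γ z) }

  same-fibre : ∀ x γ δ → (to (translate (invAut γ ∘A δ)) (x , γ)) Y.≋ (x , δ)
  same-fibre x γ δ = refl , λ z → to-cong δ (from-to γ z)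

  lift-path : ∀ {Q x y} → PathIn X Q x y → ∀ γ δ →
              Σ (Aut Y) λ α → PathIn Y Q (to α (x , γ)) (y , δ)
  lift-path {x = x} {y} (w , q , p) γ δ = α , w , q , (begin
    act Y w (to α (x , γ))   ≈⟨ Y.act-aut α w (x , γ) ⟨
    to α (act Y w (x , γ))
      ≈⟨ to-cong α {act Y w (x , γ)} {y , ε} (≡.trans (act-fst w (x , γ)) p , λ _ → ≋-refl) ⟩
    to α (y , ε)             ≈⟨ same-fibre y ε δ ⟩
    (y , δ)                  ∎)
    where
      open Y.≋-Reasoning
      ε = proj₂ (act Y w (x , γ))
      -- The lifted path ends over `y` with some label `ε`; this translation turns the label into
      -- `δ`.
      α = translate (invAut ε ∘A δ)

  face-transitive : ∀ i → (∀ x → PathIn X (_≢ i) (origin false) x) → FaceTransitive {G = Y} i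
  face-transitive i path (x , γ) (y , δ) =
    lift-path (X.path-trans (XI.path-sym (path x)) (path y)) γ δ

  lift-facet-path : ∀ {x y} → PathIn X (_≢ 2F) x y → ∀ γ → PathIn Y (_≢ 2F) (x , γ) (y , γ)
  lift-facet-path {x} (w , q , p) γ with act-trivial q x γ
  ... | p′ , q′ = w , q , ≡.trans p′ p , q′

  Y-connected : ∀ u v → PathIn Y (λ _ → ⊤) u v
  Y-connected (x , γ) (y , δ) =
    Y.path-trans {x = x , γ} {origin false , γ} {y , δ}
      (Y.path-weaken {x = x , γ} {origin false , γ} (λ _ → tt) (lift-facet-path (XI.path-sym (facet-path x)) γ))
      (Y.path-trans {x = origin false , γ} {origin false , δ} {y , δ} across
        (Y.path-weaken {x = origin false , δ} {y , δ} (λ _ → tt) (lift-facet-path (facet-path y) δ)))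
    where
      -- The τ's generate the group: Φ and its image under δγ⁻¹ lie in one orbit, so the word
      -- joining them is even and its code has voltage δγ⁻¹.
      across : PathIn Y (λ _ → ⊤) (origin false , γ) (origin false , δ)
      across with connected Φ (Φ · (δ ∘A invAut γ))
      ... | w , _ , p = hops (code w) , All.universal _ _ , (begin
        act Y (hops (code w)) (origin false , γ)  ≈⟨ act-hops (code w) (origin false) γ ⟩
        (origin false , π ∘A γ)                   ≈⟨ refl , aut-determined (π ∘A γ) δ Φ
          (≋-trans (to-cong γ (≋-trans (at-code false even) p)) (to-from γ _)) ⟩
        (origin false , δ)                        ∎)
        where
          open Y.≋-Reasoning
          π = prod (origin false) (code w)
          even = even-of-orbit w (δ ∘A invAut γ , ≋-refl) p

  -- Vertices of the derived graph as walks along Petrie polygons.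

  side-injective₂ : ∀ h h′ {j j′} → side h j ≡ side h′ j′ → h ≡ h′ × j ≡ j′
  side-injective₂ false false p = refl , side-injective false p
  side-injective₂ true  true  p = refl , side-injective true p
  side-injective₂ false true  p = ⊥-elim (side-≢ false p)
  side-injective₂ true  false p = ⊥-elim (side-≢ true p)

  -- The flags (x , γ) of a vertex, taken corner by corner, correspond to the steps
  -- of a walk of P that applies r₀ , … , r₂ₖ cyclically; z is the flag from which
  -- the current round of that walk, one Petrie step, sets out.
  Round : Flag Y → Flag P → Set
  Round (x , γ) z = Σ Bool λ h → Σ (Fin K) λ f →
    corner x ≡ side h f × walk (suc (toℕ f)) z ≋ at (not h) (Φ · γ)

  round-total : ∀ u → Σ (Flag P) (Round u)
  round-total (x , γ) = round _ (side-view (corner x)) refl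
    where
      round : ∀ i → SideView i → corner x ≡ i → Σ (Flag P) (Round (x , γ))
      round _ (mk h f) p = _ , h , f , p , walk-unwalk (suc (toℕ f)) _

  round-unique : ∀ u {z z′} → Round u z → Round u z′ → z ≋ z′
  round-unique u (h , f , p , q) (h′ , f′ , p′ , q′) with side-injective₂ h h′ (≡.trans (≡.sym p) p′)
  ... | refl , refl = walk-injective (suc (toℕ f)) (≋-trans q (≋-sym q′))

  round-cong : ∀ u v {z} → u Y.≋ v → Round u z → Round v z
  round-cong (x , γ) (.x , δ) (refl , e) (h , f , p , q) =
    h , f , p , ≋-trans q (at-cong (not h) (e Φ))

  -- Crossing the side of index `f` applies the next reflection, of colour `f` + 1. At the last
  -- index this completes the round, and the extra change of half there is the `r₀` that opens the
  -- next one, which starts at `petrie P z`.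
  round-forward : ∀ i γ {z z′} → Round ((i , false) , γ) z → Round (r Y 2F ((i , false) , γ)) z′ → z ∼ z′
  round-forward i γ {z} {z′} (h , f , refl , q) R′ =
    next (round-cong (r Y 2F u) ((side (not h) f , true) , δ) (r₂-side h f false γ) R′) (next-side (not h) f)
    where
      open ≋-Reasoning
      u = (i , false) , γ
      δ = volt h f ∘A γ

      crossed : at h (Φ · δ) ≋ r P (Fin.suc f) (walk (suc (toℕ f)) z)
      crossed = begin
        at h ((Φ · volt h f) · γ)                  ≈⟨ at-aut h γ _ ⟨
        at h (Φ · volt h f) · γ                    ≈⟨ to-cong γ (at-aut h (volt h f) Φ) ⟨
        (at h Φ · volt h f) · γ                    ≈⟨ to-cong γ (at-volt h f) ⟩
        r P (Fin.suc f) (r₀ (at h Φ)) · γ          ≈⟨ to-r γ (Fin.suc f) _ ⟩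
        r P (Fin.suc f) (r₀ (at h Φ) · γ)          ≈⟨ r-cong P (Fin.suc f) (to-cong γ (r₀-at h Φ)) ⟩
        r P (Fin.suc f) (at (not h) Φ · γ)         ≈⟨ r-cong P (Fin.suc f) (at-aut (not h) γ Φ) ⟩
        r P (Fin.suc f) (at (not h) (Φ · γ))       ≈⟨ r-cong P (Fin.suc f) q ⟨
        r P (Fin.suc f) (walk (suc (toℕ f)) z)     ∎

      continued : at h (Φ · δ) ≋ walk (suc (suc (toℕ f))) z
      continued = ≋-trans crossed (≋-reflexive (cong (λ c → r P c (walk (suc (toℕ f)) z))
                    (≡.sym (colour-unique {Fin.suc f} refl))))

      next : Round ((side (not h) f , true) , δ) z′ → _ → z ∼ z′
      next (h′ , f′ , p′ , q′) (inj₁ (f⁺ , s , e)) with side-injective₂ (not h) h′ (≡.trans (≡.sym e) p′)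
      ... | refl , refl = ∼-refl (walk-injective (suc (suc (toℕ f))) (≋-sym (begin
        walk (suc (suc (toℕ f))) z′   ≡⟨ cong (λ t → walk (suc t) z′) s ⟨
        walk (suc (toℕ f′)) z′        ≈⟨ q′ ⟩
        at (not (not h)) (Φ · δ)      ≡⟨ cong (λ g → at g (Φ · δ)) (not-involutive h) ⟩
        at h (Φ · δ)                  ≈⟨ continued ⟩
        walk (suc (suc (toℕ f))) z    ∎)))
      next (h′ , f′ , p′ , q′) (inj₂ (s , e))
        with side-injective₂ (not (not h)) h′ (≡.trans (≡.sym (e 0F refl)) p′)
      ... | refl , refl = ∼-petrie (begin
        petrie P z                        ≡⟨ petrie-walk z ⟩
        walk (suc K) z                    ≡⟨ cong (λ t → walk (suc t) z) s ⟨
        walk (suc (suc (toℕ f))) z        ≈⟨ continued ⟨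
        at h (Φ · δ)                      ≡⟨ cong (λ g → at g (Φ · δ)) (not-involutive h) ⟨
        at (not (not h)) (Φ · δ)          ≈⟨ r₀-at (not h) _ ⟨
        r₀ (at (not h) (Φ · δ))           ≡⟨ cong (λ g → r₀ (at g (Φ · δ))) (not-involutive (not h)) ⟨
        r₀ (at (not (not (not h))) (Φ · δ))  ≈⟨ r-cong P 0F q′ ⟨
        r₀ (r₀ z′)                        ≈⟨ r-invol 0F z′ ⟩
        z′                                ∎)

  round-step : ∀ i u {z z′} → 1 ≤ toℕ i → Round u z → Round (r Y i u) z′ → z ∼ z′
  round-step 0F u ()
  round-step 1F u@(x , γ) {z} _ (h , f , p , q) R′ =
    ∼-refl (round-unique (r Y 1F u) (h , f , ≡.trans (corner-r1 x) p , q) R′)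
  round-step 2F ((i , false) , γ) _ R R′ = round-forward i γ R R′
  -- From a `true` flag the crossing runs against the walk; seen from its other end it is a forward
  -- one.
  round-step 2F u@((i , true) , γ) {z} {z′} _ R R′ =
    ∼-sym (turn (r Y 2F u) (r2-flips i) R′
      (round-cong u (r Y 2F (r Y 2F u)) (Y.≋-sym {r Y 2F (r Y 2F u)} {u} (Y-invol 2F u)) R))
    where
      r2-flips : ∀ i → proj₂ (r2 (i , true)) ≡ false
      r2-flips i with side-view i
      ... | mk h j = cong proj₂ (r2-side h j true)

      turn : ∀ v → proj₂ (proj₁ v) ≡ false → Round v z′ → Round (r Y 2F v) z → z′ ∼ z
      turn ((j , .false) , δ) refl = round-forward j δ

  round-act : ∀ {w} → All (λ i → 1 ≤ toℕ i) w → ∀ u {z z′} →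
              Round u z → Round (act Y w u) z′ → z ∼ z′
  round-act {[]}    []       u R R′ = ∼-refl (round-unique u R R′)
  round-act {i ∷ w} (q ∷ qs) u R R′ with round-total (r Y i u)
  ... | _ , R″ = ∼-trans (round-step i u q R R″) (round-act qs (r Y i u) R″ R′)

  same-corner : ∀ x y {γ z z′} → z ∼ z′ → Round (x , γ) z → Round (y , γ) z′ → corner x ≡ corner y
  same-corner x y {γ} {z} {z′} z∼z′ (h , f , p , q) (h′ , f′ , p′ , q′) with h Bool.≟ h′ | f Finₚ.≟ f′
  ... | yes refl | yes refl = ≡.trans p (≡.sym p′)
  ... | yes refl | no f≢f′  = ⊥-elim (same-walk-end simple r₀-comm (Finₚ.toℕ<n f) (Finₚ.toℕ<n f′) z∼z′
          (≋-trans q (≋-sym q′)) (λ e → f≢f′ (Finₚ.toℕ-injective e)))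
  ... | no h≢h′ | _ = ⊥-elim (opposite-walk-end simple r₀-comm (Finₚ.toℕ<n f) (Finₚ.toℕ<n f′) z∼z′ (begin
          walk (suc (toℕ f)) z         ≈⟨ q ⟩
          at (not h) (Φ · γ)           ≡⟨ cong (λ g → at g (Φ · γ)) (≡.sym (¬-not (λ e → h≢h′ (≡.sym e)))) ⟩
          at h′ (Φ · γ)                ≡⟨ cong (λ g → at g (Φ · γ)) (not-involutive h′) ⟨
          at (not (not h′)) (Φ · γ)    ≈⟨ r₀-at (not h′) _ ⟨
          r₀ (at (not h′) (Φ · γ))     ≈⟨ r-cong P 0F q′ ⟨
          r₀ (walk (suc (toℕ f′)) z′)  ∎))
    where open ≋-Reasoning

  -- Colours 0 and 1 preserve the label γ, colours 1 and 2 the Petrie polygon of the round. Together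
  -- they determine the corner, which has just two flags.
  facet-vertex : ∀ u v → PathIn Y (λ j → toℕ j ≤ 1) u v → PathIn Y (λ j → 1 ≤ toℕ j) u v →
                 v Y.≋ u ⊎ v Y.≋ r Y 1F u
  facet-vertex (x , γ) (y , δ) (w , q , p) (w′ , q′ , p′) with round-total (x , γ) | round-total (y , δ)
  ... | z , R | z′ , R′ = conclude (corner-injective x y
          (same-corner x y {γ} (round-act q′ (x , γ) R (round-cong (y , δ) (act Y w′ (x , γ))
              (Y.≋-sym {act Y w′ (x , γ)} {y , δ} p′) R′))
            R (round-cong (y , δ) (y , γ) (refl , δ≈γ) R′)))
    where
      not-2 : ∀ {j : Fin 3} → toℕ j ≤ 1 → j ≢ 2F
      not-2 (s≤s ()) refl

      δ≈γ : δ ≈A γ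
      δ≈γ t = ≋-trans (≋-sym (proj₂ p t)) (proj₂ (act-trivial (All.map not-2 q) x γ) t)

      conclude : y ≡ x ⊎ y ≡ r1 x → _
      conclude (inj₁ e) = inj₁ (e , δ≈γ)
      conclude (inj₂ e) = inj₂ (e , δ≈γ)

  -- The polytope axioms and the symmetry type graph.

  Y-premaniplex : IsPremaniplex Y
  Y-premaniplex = record
    { r-invol = Y-invol
    ; r-comm = λ
        { 0F 2F _ u → closed-of-comm u
        ; 2F 0F _ u → closed-of-comm′ u
        ; 0F 0F () ; 0F 1F (s≤s ()) ; 1F 0F (s≤s ()) ; 1F 1F () ; 1F 2F (s≤s ()) ; 2F 1F (s≤s ()) ; 2F 2F () }
    ; connected = Y-connected }
    where
      open Y.≋-Reasoning
      closed-of-comm : ∀ u → r Y 0F (r Y 2F (r Y 0F (r Y 2F u))) Y.≋ u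
      closed-of-comm u = begin
        r Y 0F (r Y 2F (r Y 0F (r Y 2F u)))  ≈⟨ Y-comm (r Y 0F (r Y 2F u)) ⟩
        r Y 2F (r Y 0F (r Y 0F (r Y 2F u)))
          ≈⟨ r-cong Y 2F {r Y 0F (r Y 0F (r Y 2F u))} {r Y 2F u} (Y-invol 0F (r Y 2F u)) ⟩
        r Y 2F (r Y 2F u)                    ≈⟨ Y-invol 2F u ⟩
        u                                    ∎

      closed-of-comm′ : ∀ u → r Y 2F (r Y 0F (r Y 2F (r Y 0F u))) Y.≋ u
      closed-of-comm′ u = begin
        r Y 2F (r Y 0F (r Y 2F (r Y 0F u)))  ≈⟨ Y-comm (r Y 2F (r Y 0F u)) ⟨
        r Y 0F (r Y 2F (r Y 2F (r Y 0F u)))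
          ≈⟨ r-cong Y 0F {r Y 2F (r Y 2F (r Y 0F u))} {r Y 0F u} (Y-invol 2F (r Y 0F u)) ⟩
        r Y 0F (r Y 0F u)                    ≈⟨ Y-invol 0F u ⟩
        u                                    ∎

  one-colour-path : ∀ i u v → PathIn Y (_≡ i) u v → proj₁ v ≡ proj₁ u ⊎ proj₁ v ≡ ρX i (proj₁ u)
  one-colour-path i u v (w , q , p) with one-colour-act q
    where
      one-colour-act : ∀ {w x} → All (_≡ i) w → act X w x ≡ x ⊎ act X w x ≡ ρX i x
      one-colour-act []            = inj₁ refl
      one-colour-act {x = x} (refl ∷ qs) with one-colour-act {x = ρX i x} qs
      ... | inj₁ e = inj₂ e
      ... | inj₂ e = inj₁ (≡.trans e (ρX-invol i x))
  ... | inj₁ e = inj₁ (≡.trans (≡.sym (proj₁ p)) (≡.trans (act-fst w u) e))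
  ... | inj₂ e = inj₂ (≡.trans (≡.sym (proj₁ p)) (≡.trans (act-fst w u) e))

  not-across-r1 : ∀ i u v → i ≢ 1F → PathIn Y (_≡ i) u v → ¬ v Y.≋ r Y 1F u
  not-across-r1 i u v i≢1 p (e , _) with one-colour-path i u v p
  ... | inj₁ e′ = X-noSemiEdge 1F (proj₁ u) (≡.trans (≡.sym e) e′)
  ... | inj₂ e′ = X-noParallel i 1F (proj₁ u) i≢1 (≡.trans (≡.sym e′) e)

  -- For `l` = 0 or `m` = 2 one of the given paths already serves. Otherwise `u` and `v` share a
  -- facet and a vertex. If colour 1 is then not allowed, one of the given paths uses colour 0 alone
  -- or colour 2 alone, so it cannot end at `r Y 1F u`.
  Y-diamond : ∀ (m l : Fin 3) u v →
              PathIn Y (λ j → toℕ j ≤ toℕ m) u v → PathIn Y (λ j → toℕ l ≤ toℕ j) u v →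
              PathIn Y (λ j → toℕ l ≤ toℕ j × toℕ j ≤ toℕ m) u v
  Y-diamond m  0F u v p q = Y.path-weaken {x = u} {v} (z≤n ,_) p
  Y-diamond 2F l  u v p q = Y.path-weaken {x = u} {v} (λ {j} l≤j → l≤j , Finₚ.toℕ≤pred[n] j) q
  Y-diamond 0F (Fin.suc l) u v p q
    with facet-vertex u v (Y.path-weaken {x = u} {v} (λ j≤0 → ℕₚ.≤-trans j≤0 z≤n) p)
                          (Y.path-weaken {x = u} {v} (ℕₚ.≤-trans (s≤s z≤n)) q)
  ... | inj₁ e = Y.path-refl {x = u} {v} (Y.≋-sym {v} {u} e)
  ... | inj₂ e = ⊥-elim (not-across-r1 0F u v (λ ()) (Y.path-weaken {x = u} {v} only-0 p) e)
    where
      only-0 : ∀ {j : Fin 3} → toℕ j ≤ 0 → j ≡ 0F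
      only-0 {0F} _ = refl
  Y-diamond 1F 1F u v p q with facet-vertex u v p q
  ... | inj₁ e = Y.path-refl {x = u} {v} (Y.≋-sym {v} {u} e)
  ... | inj₂ e = 1F ∷ [] , (s≤s z≤n , s≤s z≤n) ∷ [] , Y.≋-sym {v} {r Y 1F u} e
  Y-diamond 1F 2F u v p q with facet-vertex u v p (Y.path-weaken {x = u} {v} (ℕₚ.≤-trans (s≤s z≤n)) q)
  ... | inj₁ e = Y.path-refl {x = u} {v} (Y.≋-sym {v} {u} e)
  ... | inj₂ e = ⊥-elim (not-across-r1 2F u v (λ ()) (Y.path-weaken {x = u} {v} only-2 q) e)
    where
      only-2 : ∀ {j : Fin 3} → 2 ≤ toℕ j → j ≡ 2F
      only-2 {1F} (s≤s ())
      only-2 {2F} _ = refl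

  Y-polytope : IsPolytope Y
  Y-polytope = record
    { maniplex = record
        { premaniplex = Y-premaniplex
        ; noSemiEdge  = λ i u e → X-noSemiEdge i (proj₁ u) (proj₁ e)
        ; noParallel  = λ i j u i≢j e → X-noParallel i j (proj₁ u) i≢j (proj₁ e) }
    ; diamond = Y-diamond }

  symmetry-type : Iso (SymmetryTypeGraph Y) X
  symmetry-type = record
    { to        = proj₁
    ; from      = λ x → x , idAut
    ; to-cong   = λ {u} {v} → orbit⇒≡ u v
    ; from-cong = λ { {x} refl → Y.orbit-refl {x , idAut} {x , idAut} (refl , λ _ → ≋-refl) }
    ; to-r      = λ _ _ → refl
    ; to-from   = λ _ → refl
    ; from-to   = λ (x , γ) → translate (invAut idAut ∘A γ) , same-fibre x idAut γ }

  -- An automorphism preserves the flag of `X` below, and a path inside a facet preserves the label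
  -- γ, so `u` itself is fixed.
  facet-stabiliser : TrivialFacetStabilizer Y
  facet-stabiliser α u (w , q , p) = Connected.aut-determined Y Y-premaniplex α idAut u
      (≡.sym (orbit⇒≡ u (to α u) (α , Y.≋-refl {to α u})) , λ z →
        ≋-trans (≋-sym (proj₂ (act-trivial q (proj₁ (to α u)) (proj₂ (to α u))) z)) (proj₂ p z))

theorem7p2 : (k : ℕ) → 2 ≤ k →
    (P : Raw (suc (2 * k))) →
    IsPolytope P → IsChiral {G = P} → SimplePetriePolygons P →
    (Φ : Flag P) →
    (τ : Fin (2 * k) → Aut P) →
    (∀ j → _≈_ P (Φ · τ j) (r P (Data.Fin.suc j) (r P zero Φ))) →
    let open Family2 k in
    IsPolytope (Xξ τ)
    × Iso (SymmetryTypeGraph (Xξ τ)) X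
    × VertexTransitive (Xξ τ)
    × FacetTransitive (Xξ τ)
    × TrivialFacetStabilizer (Xξ τ)
theorem7p2 (suc (suc k)) (s≤s (s≤s z≤n)) P polytope chiral simple Φ τ τΦ =
  Y-polytope , symmetry-type , face-transitive 0F vertex-path ,
  face-transitive 2F facet-path , facet-stabiliser
  where
    open Construction k P polytope chiral simple Φ τ τΦ
    open Polygon (suc (suc k))
    open Origin Fin.zero refl
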